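{- The constant $\mu=\inf\{z\in\mathbb{R} : [z,+\infty)\subset\overline{\Omega}\}$ satisfies $$\mu\le \frac{19425+111\sqrt{26565}}{2030}\ (\approx 18.4811).$$
   Context: For irrational $\alpha$ with ordinary (regular) continued fraction expansion $\alpha=[x_0;x_1,x_2,\dots]$ ($x_0\in\mathbb{Z}$, $x_i\in\mathbb{Z}_{>0}$ for $i\ge 1$), define $$\rho(\alpha)=\limsup_{n\to\infty}\bigl([x_n;x_{n-1},\dots,x_0]\cdot[x_{n+1};x_{n+2},\dots]\bigr),$$ where $[x_n;x_{n-1},\dots,x_0]$ is the finite continued fraction with the entries in that order (the last entry $x_0$ does not influence the limsup and may be omitted when $x_0\le 0$). Put $\overline{\Omega}=\{\rho(\alpha) : \alpha\in\mathbb{R}\setminus\mathbb{Q}\}$; only finite values of $\rho$ are relevant. -}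

module Defs where

open import Data.Empty using (⊥-elim)
open import Data.Integer.Base as ℤ using (ℤ; +_; 0ℤ)
import Data.Integer.Properties as ℤₚ
open import Data.List.Base using (List; []; _∷_; _++_; applyUpTo; applyDownFrom; filter)
open import Data.List.Relation.Unary.All using (All; []; _∷_)
import Data.List.Relation.Unary.All.Properties as All
open import Data.Nat.Base as ℕ using (ℕ; zero; suc; z≤n; s≤s)
import Data.Nat.Properties as ℕₚ
open import Data.Nat.Solver using (module +-*-Solver)
open import Data.Product.Base using (∃; _×_; _,_)
open import Data.Rational.Base as ℚ using (ℚ; mkℚ; 0ℚ; 1ℚ; ½; ∣_∣; 1/_; _/_)
import Data.Rational.Properties as ℚₚ
import Data.Rational.Solver as ℚ-Solver
import Data.Rational.Unnormalised.Base as ℚᵘ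
import Data.Rational.Unnormalised.Properties as ℚᵘₚ
open import Data.Sum.Base using (inj₁; inj₂)
open import Function.Base using (_∘_)
open import Level using (0ℓ)
open import Relation.Binary.PropositionalEquality
  using (_≡_; refl; sym; trans; cong; cong₂; subst; subst₂)
open import Relation.Nullary using (¬_; yes; no)
open import Relation.Unary using (Pred; _⊆_)

------------------------------------------------------------------------
-- Rational inequalities

p≤q+r⇒p-q≤r : ∀ {p q r} → p ℚ.≤ q ℚ.+ r → p ℚ.- q ℚ.≤ r
p≤q+r⇒p-q≤r {p} {q} {r} h = subst (p ℚ.- q ℚ.≤_) eq (ℚₚ.+-monoˡ-≤ (ℚ.- q) h)
  where
  open ℚ-Solver.+-*-Solver
  eq : q ℚ.+ r ℚ.- q ≡ r
  eq = solve 2 (λ q r → q :+ r :- q := r) refl q r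

∣p-q∣≤ : ∀ {p q r} → p ℚ.≤ q ℚ.+ r → q ℚ.≤ p ℚ.+ r → ∣ p ℚ.- q ∣ ℚ.≤ r
∣p-q∣≤ {p} {q} {r} p≤ q≤ with ℚₚ.∣p∣≡p∨∣p∣≡-p (p ℚ.- q)
... | inj₁ eq = subst (ℚ._≤ r) (sym eq) (p≤q+r⇒p-q≤r p≤)
... | inj₂ eq = subst (ℚ._≤ r) (sym (trans eq lemma)) (p≤q+r⇒p-q≤r q≤)
  where
  open ℚ-Solver.+-*-Solver
  lemma : ℚ.- (p ℚ.- q) ≡ q ℚ.- p
  lemma = solve 2 (λ p q → :- (p :- q) := q :- p) refl p q

½ε+½ε≡ε : ∀ ε → ½ ℚ.* ε ℚ.+ ½ ℚ.* ε ≡ ε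
½ε+½ε≡ε ε = trans (sym (ℚₚ.*-distribʳ-+ ε ½ ½)) (ℚₚ.*-identityˡ ε)

0<½ε : ∀ {ε} → 0ℚ ℚ.< ε → 0ℚ ℚ.< ½ ℚ.* ε
0<½ε {ε} 0<ε = subst (ℚ._< ½ ℚ.* ε) (ℚₚ.*-zeroʳ ½) (ℚₚ.*-monoʳ-<-pos ½ 0<ε)

/-mono-≤ : ∀ i m j n → i ℤ.* + suc n ℤ.≤ j ℤ.* + suc m → i / suc m ℚ.≤ j / suc n
/-mono-≤ i m j n h = ℚₚ.toℚᵘ-cancel-≤
  (ℚᵘₚ.≤-respˡ-≃ (ℚᵘₚ.≃-sym (ℚₚ.toℚᵘ-fromℚᵘ (ℚᵘ.mkℚᵘ i m)))
  (ℚᵘₚ.≤-respʳ-≃ (ℚᵘₚ.≃-sym (ℚₚ.toℚᵘ-fromℚᵘ (ℚᵘ.mkℚᵘ j n))) (ℚᵘ.*≤* h)))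

/-mono-< : ∀ i m j n → i ℤ.* + suc n ℤ.< j ℤ.* + suc m → i / suc m ℚ.< j / suc n
/-mono-< i m j n h = ℚₚ.toℚᵘ-cancel-<
  (ℚᵘₚ.<-respˡ-≃ (ℚᵘₚ.≃-sym (ℚₚ.toℚᵘ-fromℚᵘ (ℚᵘ.mkℚᵘ i m)))
  (ℚᵘₚ.<-respʳ-≃ (ℚᵘₚ.≃-sym (ℚₚ.toℚᵘ-fromℚᵘ (ℚᵘ.mkℚᵘ j n))) (ℚᵘ.*<* h)))

1/suc : ℕ → ℚ
1/suc n = + 1 / suc n

1/suc-antimono : ∀ {m n} → m ℕ.≤ n → 1/suc n ℚ.≤ 1/suc m
1/suc-antimono {m} {n} m≤n = /-mono-≤ (+ 1) n (+ 1) m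
  (subst₂ ℤ._≤_ (sym (ℤₚ.*-identityˡ (+ suc m))) (sym (ℤₚ.*-identityˡ (+ suc n)))
    (ℤ.+≤+ (s≤s m≤n)))

archimedean : ∀ ε → 0ℚ ℚ.< ε → ∃ λ k → 1/suc k ℚ.< ε
archimedean ε@(mkℚ (+ suc a) d _) _ = suc d ,
  subst (1/suc (suc d) ℚ.<_) (ℚₚ.↥p/↧p≡p ε) (/-mono-< (+ 1) (suc d) (+ suc a) d
    (subst₂ ℤ._<_ (sym (ℤₚ.*-identityˡ (+ suc d))) (ℤₚ.pos-* (suc a) (suc (suc d)))
      (ℤ.+<+ (ℕₚ.m≤m+n (suc (suc d)) (a ℕ.* suc (suc d))))))
archimedean (mkℚ (+ zero) d _) (ℚ.*<* (ℤ.+<+ ()))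
archimedean (mkℚ (ℤ.-[1+ _ ]) d _) (ℚ.*<* ())

------------------------------------------------------------------------
-- Real numbers: Cauchy sequences of rationals up to _≃_

Cauchy : (ℕ → ℚ) → Set
Cauchy s = ∀ ε → 0ℚ ℚ.< ε → ∃ λ N → ∀ m n → N ℕ.≤ m → N ℕ.≤ n → ∣ s m ℚ.- s n ∣ ℚ.< ε

record ℝ : Set where
  constructor mkℝ
  field
    seq    : ℕ → ℚ
    cauchy : Cauchy seq

open ℝ public

infix 4 _≃_ _<_ _≤_

_≃_ : ℝ → ℝ → Set
x ≃ y = ∀ ε → 0ℚ ℚ.< ε → ∃ λ N → ∀ n → N ℕ.≤ n → ∣ seq x n ℚ.- seq y n ∣ ℚ.< ε

_<_ : ℝ → ℝ → Set
x < y = ∃ λ ε → 0ℚ ℚ.< ε × ∃ λ N → ∀ n → N ℕ.≤ n → seq x n ℚ.+ ε ℚ.< seq y n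

_≤_ : ℝ → ℝ → Set
x ≤ y = ¬ (y < x)

<-irrefl : ∀ {x} → ¬ (x < x)
<-irrefl {x} (ε , 0<ε , N , h) = ℚₚ.<-irrefl refl (ℚₚ.<-trans
  (subst (ℚ._< seq x N ℚ.+ ε) (ℚₚ.+-identityʳ (seq x N)) (ℚₚ.+-monoʳ-< (seq x N) 0<ε))
  (h N ℕₚ.≤-refl))

fromℚ : ℚ → ℝ
fromℚ q = mkℝ (λ _ → q) λ ε 0<ε → 0 , λ _ _ _ _ →
  subst (ℚ._< ε) (sym (cong ∣_∣ (ℚₚ.+-inverseʳ q))) 0<ε

+-cauchy : ∀ {s t} → Cauchy s → Cauchy t → Cauchy (λ n → s n ℚ.+ t n)
+-cauchy {s} {t} cs ct ε 0<ε =
  let M , hs = cs (½ ℚ.* ε) (0<½ε 0<ε)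
      N , ht = ct (½ ℚ.* ε) (0<½ε 0<ε)
  in M ℕ.⊔ N , λ m n m≥ n≥ →
    subst₂ ℚ._<_ (cong ∣_∣ (sym (rearrange (s m) (t m) (s n) (t n)))) (½ε+½ε≡ε ε)
      (ℚₚ.≤-<-trans (ℚₚ.∣p+q∣≤∣p∣+∣q∣ (s m ℚ.- s n) (t m ℚ.- t n))
        (ℚₚ.+-mono-< (hs m n (ℕₚ.m⊔n≤o⇒m≤o M N m≥) (ℕₚ.m⊔n≤o⇒m≤o M N n≥))
                     (ht m n (ℕₚ.m⊔n≤o⇒n≤o M N m≥) (ℕₚ.m⊔n≤o⇒n≤o M N n≥))))
  where
  open ℚ-Solver.+-*-Solver
  rearrange : ∀ a b c d → a ℚ.+ b ℚ.- (c ℚ.+ d) ≡ (a ℚ.- c) ℚ.+ (b ℚ.- d)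
  rearrange = solve 4 (λ a b c d → a :+ b :- (c :+ d) := (a :- c) :+ (b :- d)) refl

bounded : ∀ {s} → Cauchy s → ∃ λ N → ∃ λ B → 0ℚ ℚ.< B × (∀ n → N ℕ.≤ n → ∣ s n ∣ ℚ.≤ B)
bounded {s} cs =
  let N , h = cs 1ℚ (ℚₚ.positive⁻¹ 1ℚ)
  in N , 1ℚ ℚ.+ ∣ s N ∣ ,
     ℚₚ.+-mono-<-≤ (ℚₚ.positive⁻¹ 1ℚ) (ℚₚ.0≤∣p∣ (s N)) ,
     λ n n≥ → ℚₚ.≤-trans
       (subst (ℚ._≤ ∣ s n ℚ.- s N ∣ ℚ.+ ∣ s N ∣) (cong ∣_∣ (cancel (s n) (s N)))
         (ℚₚ.∣p+q∣≤∣p∣+∣q∣ (s n ℚ.- s N) (s N)))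
       (ℚₚ.+-monoˡ-≤ ∣ s N ∣ (ℚₚ.<⇒≤ (h n N n≥ ℕₚ.≤-refl)))
  where
  open ℚ-Solver.+-*-Solver
  cancel : ∀ a b → a ℚ.- b ℚ.+ b ≡ a
  cancel = solve 2 (λ a b → a :- b :+ b := a) refl

small-factor : ∀ C ε → 0ℚ ℚ.< C → 0ℚ ℚ.< ε →
  ∃ λ δ → 0ℚ ℚ.< δ × (∀ p q → ∣ p ∣ ℚ.≤ C → ∣ q ∣ ℚ.< δ → ∣ p ℚ.* q ∣ ℚ.< ε)
small-factor C ε 0<C 0<ε = δ , 0<δ , λ p q p≤ q< →
  subst₂ ℚ._<_ (sym (ℚₚ.∣p*q∣≡∣p∣*∣q∣ p q)) Cδ≡ε
    (ℚₚ.≤-<-trans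
      (ℚₚ.*-monoʳ-≤-nonNeg ∣ q ∣ {{ℚ.nonNegative (ℚₚ.0≤∣p∣ q)}} p≤)
      (ℚₚ.*-monoʳ-<-pos C q<))
  where
  instance
    C-positive : ℚ.Positive C
    C-positive = ℚ.positive 0<C
    C-nonZero : ℚ.NonZero C
    C-nonZero = ℚₚ.pos⇒nonZero C
    1/C-positive : ℚ.Positive (1/ C)
    1/C-positive = ℚₚ.1/pos⇒pos C

  δ : ℚ
  δ = 1/ C ℚ.* ε

  0<δ : 0ℚ ℚ.< δ
  0<δ = subst (ℚ._< δ) (ℚₚ.*-zeroʳ (1/ C)) (ℚₚ.*-monoʳ-<-pos (1/ C) 0<ε)

  Cδ≡ε : C ℚ.* δ ≡ ε
  Cδ≡ε = trans (sym (ℚₚ.*-assoc C (1/ C) ε))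
    (trans (cong (ℚ._* ε) (ℚₚ.*-inverseʳ C)) (ℚₚ.*-identityˡ ε))

*-cauchy : ∀ {s t} → Cauchy s → Cauchy t → Cauchy (λ n → s n ℚ.* t n)
*-cauchy {s} {t} cs ct ε 0<ε =
  let K , A , 0<A , hA = bounded cs
      L , B , 0<B , hB = bounded ct
      δ , 0<δ , small-s = small-factor A (½ ℚ.* ε) 0<A (0<½ε 0<ε)
      η , 0<η , small-t = small-factor B (½ ℚ.* ε) 0<B (0<½ε 0<ε)
      M , hs = cs η 0<η
      N , ht = ct δ 0<δ
  in K ℕ.⊔ L ℕ.⊔ (M ℕ.⊔ N) , λ m n m≥ n≥ →
    let KL≤m = ℕₚ.m⊔n≤o⇒m≤o (K ℕ.⊔ L) (M ℕ.⊔ N) m≥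
        KL≤n = ℕₚ.m⊔n≤o⇒m≤o (K ℕ.⊔ L) (M ℕ.⊔ N) n≥
        MN≤m = ℕₚ.m⊔n≤o⇒n≤o (K ℕ.⊔ L) (M ℕ.⊔ N) m≥
        MN≤n = ℕₚ.m⊔n≤o⇒n≤o (K ℕ.⊔ L) (M ℕ.⊔ N) n≥
    in subst₂ ℚ._<_ (cong ∣_∣ (sym (rearrange (s m) (t m) (s n) (t n)))) (½ε+½ε≡ε ε)
      (ℚₚ.≤-<-trans (ℚₚ.∣p+q∣≤∣p∣+∣q∣ (s m ℚ.* (t m ℚ.- t n)) (t n ℚ.* (s m ℚ.- s n)))
        (ℚₚ.+-mono-<
          (small-s (s m) (t m ℚ.- t n) (hA m (ℕₚ.m⊔n≤o⇒m≤o K L KL≤m))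
            (ht m n (ℕₚ.m⊔n≤o⇒n≤o M N MN≤m) (ℕₚ.m⊔n≤o⇒n≤o M N MN≤n)))
          (small-t (t n) (s m ℚ.- s n) (hB n (ℕₚ.m⊔n≤o⇒n≤o K L KL≤n))
            (hs m n (ℕₚ.m⊔n≤o⇒m≤o M N MN≤m) (ℕₚ.m⊔n≤o⇒m≤o M N MN≤n)))))
  where
  open ℚ-Solver.+-*-Solver
  rearrange : ∀ a b c d → a ℚ.* b ℚ.- c ℚ.* d ≡ a ℚ.* (b ℚ.- d) ℚ.+ d ℚ.* (a ℚ.- c)
  rearrange = solve 4 (λ a b c d → a :* b :- c :* d := a :* (b :- d) :+ d :* (a :- c)) refl

infixl 6 _+_
infixl 7 _*_

_+_ : ℝ → ℝ → ℝ
x + y = mkℝ (λ n → seq x n ℚ.+ seq y n) (+-cauchy {seq x} {seq y} (cauchy x) (cauchy y))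

_*_ : ℝ → ℝ → ℝ
x * y = mkℝ (λ n → seq x n ℚ.* seq y n) (*-cauchy {seq x} {seq y} (cauchy x) (cauchy y))

isqrt : ℕ → ℕ
isqrt zero = 0
isqrt (suc n) with isqrt n
... | r with suc r ℕ.* suc r ℕₚ.≤? suc n
...   | yes _ = suc r
...   | no  _ = r

isqrt-lower : ∀ n → isqrt n ℕ.* isqrt n ℕ.≤ n
isqrt-lower zero = z≤n
isqrt-lower (suc n) with isqrt n | isqrt-lower n
... | r | ih with suc r ℕ.* suc r ℕₚ.≤? suc n
...   | yes p = p
...   | no  _ = ℕₚ.m≤n⇒m≤1+n ih

isqrt-upper : ∀ n → n ℕ.< suc (isqrt n) ℕ.* suc (isqrt n)
isqrt-upper zero = s≤s z≤n
isqrt-upper (suc n) with isqrt n | isqrt-upper n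
... | r | ih with suc r ℕ.* suc r ℕₚ.≤? suc n
...   | yes _ = ℕₚ.≤-<-trans ih (ℕₚ.*-mono-< (ℕₚ.n<1+n (suc r)) (ℕₚ.n<1+n (suc r)))
...   | no ¬p = ℕₚ.≰⇒> ¬p

-- The n-th approximation is ⌊√(m·N²)⌋ / N with N = n + 1; it lies within 1/N below √m.
√-seq : ℕ → ℕ → ℚ
√-seq m n = + isqrt (m ℕ.* (suc n ℕ.* suc n)) / suc n

/-suc : ∀ a n → + suc a / suc n ≡ (+ a / suc n) ℚ.+ 1/suc n
/-suc a n = ℚₚ.toℚᵘ-injective (begin
  ℚ.toℚᵘ (+ suc a / suc n)                       ≈⟨ ℚₚ.toℚᵘ-fromℚᵘ (ℚᵘ.mkℚᵘ (+ suc a) n) ⟩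
  ℚᵘ.mkℚᵘ (+ suc a) n                            ≈⟨ ℚᵘ.*≡* eq ⟩
  ℚᵘ.mkℚᵘ (+ a) n ℚᵘ.+ ℚᵘ.mkℚᵘ (+ 1) n           ≈⟨ ℚᵘₚ.+-cong (ℚₚ.toℚᵘ-fromℚᵘ (ℚᵘ.mkℚᵘ (+ a) n)) (ℚₚ.toℚᵘ-fromℚᵘ (ℚᵘ.mkℚᵘ (+ 1) n)) ⟨
  ℚ.toℚᵘ (+ a / suc n) ℚᵘ.+ ℚ.toℚᵘ (1/suc n)     ≈⟨ ℚₚ.toℚᵘ-homo-+ (+ a / suc n) (1/suc n) ⟨
  ℚ.toℚᵘ ((+ a / suc n) ℚ.+ 1/suc n)             ∎)
  where
  open ℚᵘₚ.≃-Reasoning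
  natEq : suc a ℕ.* (suc n ℕ.* suc n) ≡ (a ℕ.* suc n ℕ.+ 1 ℕ.* suc n) ℕ.* suc n
  natEq = solve 2 (λ a N → (con 1 :+ a) :* (N :* N) := (a :* N :+ con 1 :* N) :* N) refl a (suc n)
    where open +-*-Solver
  eq : + suc a ℤ.* + (suc n ℕ.* suc n) ≡ (+ a ℤ.* + suc n ℤ.+ + 1 ℤ.* + suc n) ℤ.* + suc n
  eq = trans (sym (ℤₚ.pos-* (suc a) (suc n ℕ.* suc n))) (trans (cong +_ natEq)
    (trans (ℤₚ.pos-* (a ℕ.* suc n ℕ.+ 1 ℕ.* suc n) (suc n))
      (cong (ℤ._* + suc n) (trans (ℤₚ.pos-+ (a ℕ.* suc n) (1 ℕ.* suc n))
        (cong₂ ℤ._+_ (ℤₚ.pos-* a (suc n)) (ℤₚ.pos-* 1 (suc n)))))))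

√-seq-close : ∀ m i j → √-seq m i ℚ.≤ √-seq m j ℚ.+ 1/suc j
√-seq-close m i j = subst (√-seq m i ℚ.≤_) (/-suc a j)
  (/-mono-≤ (+ b) i (+ suc a) j
    (subst₂ ℤ._≤_ (ℤₚ.pos-* b (suc j)) (ℤₚ.pos-* (suc a) (suc i)) (ℤ.+≤+ bJ≤)))
  where
  a b I J : ℕ
  a = isqrt (m ℕ.* (suc j ℕ.* suc j))
  b = isqrt (m ℕ.* (suc i ℕ.* suc i))
  I = suc i
  J = suc j
  open +-*-Solver
  sq-comm : ∀ x y → x ℕ.* y ℕ.* (x ℕ.* y) ≡ x ℕ.* x ℕ.* (y ℕ.* y)
  sq-comm = solve 2 (λ x y → x :* y :* (x :* y) := x :* x :* (y :* y)) refl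
  swap : ∀ x y z → x ℕ.* (y ℕ.* y) ℕ.* (z ℕ.* z) ≡ x ℕ.* (z ℕ.* z) ℕ.* (y ℕ.* y)
  swap = solve 3 (λ x y z → x :* (y :* y) :* (z :* z) := x :* (z :* z) :* (y :* y)) refl
  squares : b ℕ.* J ℕ.* (b ℕ.* J) ℕ.≤ suc a ℕ.* I ℕ.* (suc a ℕ.* I)
  squares = begin
    b ℕ.* J ℕ.* (b ℕ.* J)              ≡⟨ sq-comm b J ⟩
    b ℕ.* b ℕ.* (J ℕ.* J)              ≤⟨ ℕₚ.*-monoˡ-≤ (J ℕ.* J) (isqrt-lower (m ℕ.* (I ℕ.* I))) ⟩
    m ℕ.* (I ℕ.* I) ℕ.* (J ℕ.* J)      ≡⟨ swap m I J ⟩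
    m ℕ.* (J ℕ.* J) ℕ.* (I ℕ.* I)      ≤⟨ ℕₚ.*-monoˡ-≤ (I ℕ.* I) (ℕₚ.<⇒≤ (isqrt-upper (m ℕ.* (J ℕ.* J)))) ⟩
    suc a ℕ.* suc a ℕ.* (I ℕ.* I)      ≡⟨ sq-comm (suc a) I ⟨
    suc a ℕ.* I ℕ.* (suc a ℕ.* I)      ∎
    where open ℕₚ.≤-Reasoning
  bJ≤ : b ℕ.* J ℕ.≤ suc a ℕ.* I
  bJ≤ = ℕₚ.≮⇒≥ λ lt → ℕₚ.<⇒≱ (ℕₚ.*-mono-< lt lt) squares

√-cauchy : ∀ m → Cauchy (√-seq m)
√-cauchy m ε 0<ε =
  let k , 1/k<ε = archimedean ε 0<ε
  in k , λ i j k≤i k≤j → ℚₚ.≤-<-trans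
    (∣p-q∣≤ (ℚₚ.≤-trans (√-seq-close m i j) (ℚₚ.+-monoʳ-≤ (√-seq m j) (1/suc-antimono k≤j)))
            (ℚₚ.≤-trans (√-seq-close m j i) (ℚₚ.+-monoʳ-≤ (√-seq m i) (1/suc-antimono k≤i))))
    1/k<ε

infix 8 √_

√_ : ℕ → ℝ
√ m = mkℝ (√-seq m) (√-cauchy m)

------------------------------------------------------------------------
-- Regular continued fractions

-- Totalised with inv 0 = 0; only ever applied to values that are at least 1.
inv : ℚ → ℚ
inv q with q ℚₚ.≟ 0ℚ
... | yes _  = 0ℚ
... | no q≢0 = (1/ q) {{ℚ.≢-nonZero q≢0}}

-- The finite continued fraction [a₀; a₁, …, aₖ]; the value at the empty list is junk.
⟦_⟧ : List ℤ → ℚ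
⟦ [] ⟧         = 0ℚ
⟦ a ∷ [] ⟧     = a / 1
⟦ a ∷ b ∷ as ⟧ = a / 1 ℚ.+ inv ⟦ b ∷ as ⟧

convergent : (ℕ → ℤ) → ℕ → ℚ
convergent a n = ⟦ applyUpTo a (suc n) ⟧

0≤1 : 0ℚ ℚ.≤ 1ℚ
0≤1 = ℚₚ.<⇒≤ (ℚₚ.positive⁻¹ 1ℚ)

0≤inv : ∀ {q} → 0ℚ ℚ.≤ q → 0ℚ ℚ.≤ inv q
0≤inv {q} 0≤q with q ℚₚ.≟ 0ℚ
... | yes _  = ℚₚ.≤-refl
... | no q≢0 = ℚₚ.<⇒≤ (ℚₚ.positive⁻¹ _ {{ℚₚ.1/pos⇒pos q {{q-pos}}}})
  where
  q-pos : ℚ.Positive q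
  q-pos = ℚₚ.nonNeg∧nonZero⇒pos q {{ℚ.nonNegative 0≤q}} {{ℚ.≢-nonZero q≢0}}

*-inv : ∀ {q} → 1ℚ ℚ.≤ q → q ℚ.* inv q ≡ 1ℚ
*-inv {q} 1≤q with q ℚₚ.≟ 0ℚ
... | yes q≡0 = ⊥-elim (ℚₚ.<-irrefl refl (ℚₚ.<-≤-trans (ℚₚ.positive⁻¹ 1ℚ) (subst (1ℚ ℚ.≤_) q≡0 1≤q)))
... | no q≢0  = ℚₚ.*-inverseʳ q {{ℚ.≢-nonZero q≢0}}

inv≤1 : ∀ {q} → 1ℚ ℚ.≤ q → inv q ℚ.≤ 1ℚ
inv≤1 {q} 1≤q = subst₂ ℚ._≤_ (ℚₚ.*-identityˡ (inv q)) (*-inv 1≤q)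
  (ℚₚ.*-monoʳ-≤-nonNeg (inv q) {{ℚ.nonNegative (0≤inv (ℚₚ.≤-trans 0≤1 1≤q))}} 1≤q)

1≤int : ∀ {a} → 0ℤ ℤ.< a → 1ℚ ℚ.≤ a / 1
1≤int {a} 0<a = /-mono-≤ (+ 1) 0 a 0
  (subst (+ 1 ℤ.≤_) (sym (ℤₚ.*-identityʳ a)) (ℤₚ.i<j⇒suc[i]≤j 0<a))

≤+nonNeg : ∀ {p q} → 0ℚ ℚ.≤ q → p ℚ.≤ p ℚ.+ q
≤+nonNeg {p} {q} 0≤q = subst (ℚ._≤ p ℚ.+ q) (ℚₚ.+-identityʳ p) (ℚₚ.+-monoʳ-≤ p 0≤q)

convergent-lower : ∀ a n → (∀ i → 0ℤ ℤ.< a (suc i)) → a 0 / 1 ℚ.≤ convergent a n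
convergent-lower a zero    a⁺ = ℚₚ.≤-refl
convergent-lower a (suc n) a⁺ = ≤+nonNeg (0≤inv
  (ℚₚ.≤-trans (ℚₚ.≤-trans 0≤1 (1≤int (a⁺ 0))) (convergent-lower (a ∘ suc) n (a⁺ ∘ suc))))

1≤convergent : ∀ a n → (∀ i → 0ℤ ℤ.< a i) → 1ℚ ℚ.≤ convergent a n
1≤convergent a n a⁺ = ℚₚ.≤-trans (1≤int (a⁺ 0)) (convergent-lower a n (a⁺ ∘ suc))

convergent-upper : ∀ a n → (∀ i → 0ℤ ℤ.< a (suc i)) → convergent a n ℚ.≤ a 0 / 1 ℚ.+ 1ℚ
convergent-upper a zero    a⁺ = ≤+nonNeg 0≤1
convergent-upper a (suc n) a⁺ = ℚₚ.+-monoʳ-≤ (a 0 / 1) (inv≤1 (1≤convergent (a ∘ suc) n a⁺))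

½*1/suc≤ : ∀ k → ½ ℚ.* 1/suc k ℚ.≤ 1/suc (suc k)
½*1/suc≤ k = ℚₚ.toℚᵘ-cancel-≤
  (ℚᵘₚ.≤-respˡ-≃ (ℚᵘₚ.≃-sym (ℚᵘₚ.≃-trans (ℚₚ.toℚᵘ-homo-* ½ (1/suc k))
      (ℚᵘₚ.*-congˡ {ℚ.toℚᵘ ½} (ℚₚ.toℚᵘ-fromℚᵘ (ℚᵘ.mkℚᵘ (+ 1) k)))))
  (ℚᵘₚ.≤-respʳ-≃ (ℚᵘₚ.≃-sym (ℚₚ.toℚᵘ-fromℚᵘ (ℚᵘ.mkℚᵘ (+ 1) (suc k))))
    (ℚᵘ.*≤* (ℤ.+≤+ le))))
  where
  le : suc (suc k) ℕ.+ 0 ℕ.≤ 2 ℕ.* suc k ℕ.+ 0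
  le = ℕₚ.+-monoˡ-≤ 0 (subst (suc (suc k) ℕ.≤_) (sym (ℕₚ.*-suc 2 k))
         (ℕₚ.+-monoʳ-≤ 2 (ℕₚ.m≤m+n k (k ℕ.+ 0))))

1≤step : ∀ {b w} → 1ℚ ℚ.≤ b → 1ℚ ℚ.≤ w → 1ℚ ℚ.≤ b ℚ.+ inv w
1≤step 1≤b 1≤w = ℚₚ.≤-trans 1≤b (≤+nonNeg (0≤inv (ℚₚ.≤-trans 0≤1 1≤w)))

*-nonNeg : ∀ {p q} → 0ℚ ℚ.≤ p → 0ℚ ℚ.≤ q → 0ℚ ℚ.≤ p ℚ.* q
*-nonNeg {p} {q} 0≤p 0≤q = ℚₚ.nonNegative⁻¹ (p ℚ.* q)
  {{ℚₚ.nonNeg*nonNeg⇒nonNeg p {{ℚ.nonNegative 0≤p}} q {{ℚ.nonNegative 0≤q}}}}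

shrink : ℚ → ℚ → ℚ
shrink b w = inv (b ℚ.+ inv w) ℚ.* inv w

0≤shrink : ∀ {b w} → 1ℚ ℚ.≤ b → 1ℚ ℚ.≤ w → 0ℚ ℚ.≤ shrink b w
0≤shrink 1≤b 1≤w =
  *-nonNeg (0≤inv (ℚₚ.≤-trans 0≤1 (1≤step 1≤b 1≤w))) (0≤inv (ℚₚ.≤-trans 0≤1 1≤w))

shrink≤½ : ∀ {b w} → 1ℚ ℚ.≤ b → 1ℚ ℚ.≤ w → shrink b w ℚ.≤ ½
shrink≤½ {b} {w} 1≤b 1≤w = subst₂ ℚ._≤_ eq₁ (ℚₚ.*-identityʳ ½)
  (ℚₚ.*-monoˡ-≤-nonNeg ½ (subst ((1ℚ ℚ.+ 1ℚ) ℚ.* P ℚ.≤_) eq₂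
    (ℚₚ.*-monoʳ-≤-nonNeg P {{ℚ.nonNegative (0≤shrink 1≤b 1≤w)}} 2≤Ww)))
  where
  W P : ℚ
  W = b ℚ.+ inv w
  P = shrink b w
  eq₁ : ½ ℚ.* ((1ℚ ℚ.+ 1ℚ) ℚ.* P) ≡ P
  eq₁ = trans (sym (ℚₚ.*-assoc ½ (1ℚ ℚ.+ 1ℚ) P)) (ℚₚ.*-identityˡ P)
  rearrange : ∀ p q x y → p ℚ.* q ℚ.* (x ℚ.* y) ≡ (p ℚ.* x) ℚ.* (q ℚ.* y)
  rearrange = solve 4 (λ p q x y → p :* q :* (x :* y) := (p :* x) :* (q :* y)) refl
    where open ℚ-Solver.+-*-Solver
  eq₂ : W ℚ.* w ℚ.* P ≡ 1ℚ
  eq₂ = trans (rearrange W w (inv W) (inv w))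
    (cong₂ ℚ._*_ (*-inv (1≤step 1≤b 1≤w)) (*-inv 1≤w))
  1≤bw : 1ℚ ℚ.≤ b ℚ.* w
  1≤bw = ℚₚ.≤-trans 1≤w (subst (ℚ._≤ b ℚ.* w) (ℚₚ.*-identityˡ w)
    (ℚₚ.*-monoʳ-≤-nonNeg w {{ℚ.nonNegative (ℚₚ.≤-trans 0≤1 1≤w)}} 1≤b))
  2≤Ww : 1ℚ ℚ.+ 1ℚ ℚ.≤ W ℚ.* w
  2≤Ww = subst (1ℚ ℚ.+ 1ℚ ℚ.≤_)
    (sym (trans (ℚₚ.*-distribʳ-+ w b (inv w))
      (cong (b ℚ.* w ℚ.+_) (trans (ℚₚ.*-comm (inv w) w) (*-inv 1≤w)))))
    (ℚₚ.+-monoˡ-≤ 1ℚ 1≤bw)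

-- One step of the expansion need not contract, but two steps halve distances.
two-steps : ∀ c {b u v} → 1ℚ ℚ.≤ b → 1ℚ ℚ.≤ u → 1ℚ ℚ.≤ v →
  ∣ (c ℚ.+ inv (b ℚ.+ inv u)) ℚ.- (c ℚ.+ inv (b ℚ.+ inv v)) ∣ ℚ.≤ ½ ℚ.* ∣ u ℚ.- v ∣
two-steps c {b} {u} {v} 1≤b 1≤u 1≤v = begin
  ∣ (c ℚ.+ X) ℚ.- (c ℚ.+ Y) ∣          ≡⟨ cong ∣_∣ eq ⟩
  ∣ Pu ℚ.* Pv ℚ.* (u ℚ.- v) ∣          ≡⟨ ℚₚ.∣p*q∣≡∣p∣*∣q∣ (Pu ℚ.* Pv) (u ℚ.- v) ⟩
  ∣ Pu ℚ.* Pv ∣ ℚ.* ∣ u ℚ.- v ∣        ≡⟨ cong (ℚ._* ∣ u ℚ.- v ∣) (ℚₚ.0≤p⇒∣p∣≡p (*-nonNeg (0≤shrink 1≤b 1≤u) (0≤shrink 1≤b 1≤v))) ⟩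
  Pu ℚ.* Pv ℚ.* ∣ u ℚ.- v ∣            ≤⟨ ℚₚ.*-monoʳ-≤-nonNeg ∣ u ℚ.- v ∣ {{ℚ.nonNegative (ℚₚ.0≤∣p∣ (u ℚ.- v))}} PuPv≤½ ⟩
  ½ ℚ.* ∣ u ℚ.- v ∣                    ∎
  where
  open ℚₚ.≤-Reasoning
  open ℚ-Solver.+-*-Solver
  x y X Y Pu Pv : ℚ
  x  = inv u
  y  = inv v
  X  = inv (b ℚ.+ x)
  Y  = inv (b ℚ.+ y)
  Pu = shrink b u
  Pv = shrink b v

  ½≤1 : ½ ℚ.≤ 1ℚ
  ½≤1 = /-mono-≤ (+ 1) 1 (+ 1) 0 (ℤ.+≤+ (s≤s z≤n))

  PuPv≤½ : Pu ℚ.* Pv ℚ.≤ ½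
  PuPv≤½ = ℚₚ.≤-trans
    (ℚₚ.*-monoʳ-≤-nonNeg Pv {{ℚ.nonNegative (0≤shrink 1≤b 1≤v)}} (shrink≤½ 1≤b 1≤u))
    (subst (½ ℚ.* Pv ℚ.≤_) (ℚₚ.*-identityʳ ½)
      (ℚₚ.*-monoˡ-≤-nonNeg ½ (ℚₚ.≤-trans (shrink≤½ 1≤b 1≤v) ½≤1)))

  cancel : ∀ c X Y → (c ℚ.+ X) ℚ.- (c ℚ.+ Y) ≡ X ℚ.- Y
  cancel = solve 3 (λ c X Y → (c :+ X) :- (c :+ Y) := X :- Y) refl

  expand : ∀ {p q P Q} → p ℚ.* P ≡ 1ℚ → q ℚ.* Q ≡ 1ℚ → P ℚ.- Q ≡ P ℚ.* Q ℚ.* (q ℚ.- p)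
  expand {p} {q} {P} {Q} pP qQ = trans
    (cong₂ ℚ._-_ (trans (sym (ℚₚ.*-identityʳ P)) (cong (P ℚ.*_) (sym qQ)))
                 (trans (sym (ℚₚ.*-identityʳ Q)) (cong (Q ℚ.*_) (sym pP))))
    (solve 4 (λ p q P Q → P :* (q :* Q) :- Q :* (p :* P) := P :* Q :* (q :- p)) refl p q P Q)

  eq : (c ℚ.+ X) ℚ.- (c ℚ.+ Y) ≡ Pu ℚ.* Pv ℚ.* (u ℚ.- v)
  eq = trans (cancel c X Y)
    (trans (expand {b ℚ.+ x} {b ℚ.+ y} {X} {Y} (*-inv (1≤step 1≤b 1≤u)) (*-inv (1≤step 1≤b 1≤v)))
    (trans (cong (X ℚ.* Y ℚ.*_) (trans (cancel b y x) (expand {v} {u} {y} {x} (*-inv 1≤v) (*-inv 1≤u))))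
      (solve 6 (λ X Y x y u v → X :* Y :* (y :* x :* (u :- v)) := X :* x :* (Y :* y) :* (u :- v))
        refl X Y x y u v)))

convergents-close : ∀ k a m n → (∀ i → 0ℤ ℤ.< a (suc i)) → k ℕ.+ k ℕ.≤ m → k ℕ.+ k ℕ.≤ n →
  ∣ convergent a m ℚ.- convergent a n ∣ ℚ.≤ 1/suc k
convergents-close zero a m n a⁺ _ _ = ∣p-q∣≤
  (ℚₚ.≤-trans (convergent-upper a m a⁺) (ℚₚ.+-monoˡ-≤ 1ℚ (convergent-lower a n a⁺)))
  (ℚₚ.≤-trans (convergent-upper a n a⁺) (ℚₚ.+-monoˡ-≤ 1ℚ (convergent-lower a m a⁺)))
convergents-close (suc k) a (suc m) (suc n) a⁺ (s≤s m≥) (s≤s n≥)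
  with m | n | subst (ℕ._≤ m) (ℕₚ.+-suc k k) m≥ | subst (ℕ._≤ n) (ℕₚ.+-suc k k) n≥
... | suc m | suc n | s≤s m≥ | s≤s n≥ = ℚₚ.≤-trans
  (two-steps (a 0 / 1) (1≤int (a⁺ 0)) (1≤convergent a″ m a″⁺) (1≤convergent a″ n a″⁺))
  (ℚₚ.≤-trans (ℚₚ.*-monoˡ-≤-nonNeg ½ (convergents-close k a″ m n (a″⁺ ∘ suc) m≥ n≥))
    (½*1/suc≤ k))
  where
  a″ : ℕ → ℤ
  a″ = a ∘ suc ∘ suc
  a″⁺ : ∀ i → 0ℤ ℤ.< a″ i
  a″⁺ = a⁺ ∘ suc

convergents-cauchy : ∀ a → (∀ i → 0ℤ ℤ.< a (suc i)) → Cauchy (convergent a)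
convergents-cauchy a a⁺ ε 0<ε =
  let k , 1/k<ε = archimedean ε 0<ε
  in k ℕ.+ k , λ m n m≥ n≥ → ℚₚ.≤-<-trans (convergents-close k a m n a⁺ m≥ n≥) 1/k<ε

record RegularCF : Set where
  constructor mkCF
  field
    quotient          : ℕ → ℤ
    quotient-positive : ∀ n → 0ℤ ℤ.< quotient (suc n)

open RegularCF public

value : RegularCF → ℝ
value x = mkℝ (convergent (quotient x)) (convergents-cauchy (quotient x) (quotient-positive x))

-- [xₘ; xₘ₊₁, …]
tailFrom : ℕ → RegularCF → RegularCF
tailFrom m x = mkCF (λ n → quotient x (n ℕ.+ m)) (λ n → quotient-positive x (n ℕ.+ m))

-- [xₙ; xₙ₋₁, …, x₀], where the last entry x₀ is kept only if it is positive.
reversed : RegularCF → ℕ → ℚ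
reversed x n =
  ⟦ applyDownFrom (quotient x ∘ suc) n ++ filter (0ℤ ℤₚ.<?_) (quotient x 0 ∷ []) ⟧

------------------------------------------------------------------------
-- The spectrum

Irrational : ℝ → Set
Irrational α = ∀ q → ¬ (α ≃ fromℚ q)

IsLimSup : (ℕ → ℝ) → ℝ → Set
IsLimSup u z =
  (∀ ε → 0ℚ ℚ.< ε → ∃ λ N → ∀ n → N ℕ.≤ n → u n < z + fromℚ ε) ×
  (∀ ε → 0ℚ ℚ.< ε → ∀ N → ∃ λ n → N ℕ.≤ n × z < u n + fromℚ ε)

-- ρ α is a partial function (it may be infinite), hence given by its graph; the
-- expansion x of an irrational α is unique.
ρ_≔_ : ℝ → ℝ → Set
ρ α ≔ z = ∃ λ x → α ≃ value x ×
  IsLimSup (λ n → fromℚ (reversed x n) * value (tailFrom (suc n) x)) z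

Ω̄ : Pred ℝ 0ℓ
Ω̄ z = ∃ λ α → Irrational α × ρ α ≔ z

[_,+∞[ : ℝ → Pred ℝ 0ℓ
[ z ,+∞[ w = z ≤ w

0≤⟦⟧ : ∀ {as} → All (0ℤ ℤ.<_) as → 0ℚ ℚ.≤ ⟦ as ⟧
0≤⟦⟧ []            = ℚₚ.≤-refl
0≤⟦⟧ (a⁺ ∷ [])     = ℚₚ.≤-trans 0≤1 (1≤int a⁺)
0≤⟦⟧ (a⁺ ∷ b⁺ ∷ h) = ℚₚ.+-mono-≤ (ℚₚ.≤-trans 0≤1 (1≤int a⁺)) (0≤inv (0≤⟦⟧ (b⁺ ∷ h)))

0≤reversed : ∀ x n → 0ℚ ℚ.≤ reversed x n
0≤reversed x n = 0≤⟦⟧ (All.++⁺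
  (All.applyDownFrom⁺₂ (quotient x ∘ suc) n (quotient-positive x))
  (All.all-filter (0ℤ ℤₚ.<?_) (quotient x 0 ∷ [])))

0≤forward : ∀ x n k → 0ℚ ℚ.≤ seq (value (tailFrom (suc n) x)) k
0≤forward x n k = ℚₚ.≤-trans 0≤1 (1≤convergent (quotient (tailFrom (suc n) x)) k λ i →
  subst (λ j → 0ℤ ℤ.< quotient x j) (sym (ℕₚ.+-suc i n)) (quotient-positive x (i ℕ.+ n)))

Ω̄-nonNegative : ∀ {z} → Ω̄ z → fromℚ 0ℚ ≤ z
Ω̄-nonNegative {z} (_ , _ , x , _ , (above , _)) (ε , 0<ε , K , z+ε<0) =
  let N , u<z+ε = above ε 0<ε
      δ , 0<δ , L , u+δ<z+ε = u<z+ε N ℕₚ.≤-refl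
      k = K ℕ.⊔ L
      0≤u = *-nonNeg (0≤reversed x N) (0≤forward x N k)
  in ℚₚ.<-irrefl refl (ℚₚ.≤-<-trans (ℚₚ.+-mono-≤ 0≤u (ℚₚ.<⇒≤ 0<δ))
       (ℚₚ.<-trans (u+δ<z+ε k (ℕₚ.m≤n⊔m K L)) (z+ε<0 k (ℕₚ.m≤m⊔n K L))))

-- Constructively a set of reals has an infimum in the upper reals: a number given by
-- the rationals lying strictly above it.
UpperReal : Set₁
UpperReal = Pred ℚ 0ℓ

inf : Pred ℝ 0ℓ → UpperReal
inf S q = ∃ λ z → S z × z < fromℚ q

infix 4 _≤ᵘ_

_≤ᵘ_ : UpperReal → ℝ → Set
u ≤ᵘ x = ∀ q → x < fromℚ q → u q

rays : Pred ℝ 0ℓ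
rays z = [ z ,+∞[ ⊆ Ω̄

-- The set is bounded below, so its infimum is never −∞.
rays-nonNegative : ∀ {z} → rays z → fromℚ 0ℚ ≤ z
rays-nonNegative {z} ray = Ω̄-nonNegative {z} (ray {z} (<-irrefl {z}))

μ : UpperReal
μ = inf rays

{-# OPTIONS --safe #-}

-- In fact [92/5, ∞) ⊂ Ω̄, and 92/5 = 18.4 lies below the stated constant.
--
-- A number t ≥ 92/5 is realised at positions between two adjacent quotients a, b ≥ 4 with
-- |a − b| ≤ 1, as t = [a; v]·[b; w] with v and w in a Cantor set of continued fractions with
-- digits at most 4.  Forbidding 44, 4134 and 4314 in v and w keeps the products at all other
-- positions at most 92/5 if a = b = 4: at the only critical pair 4|3 they are bounded by
-- [4; 1, 4]·[3; 1, 5] = 92/5 or [4; 1, 5]·[3; 1, 4] < 92/5.  If (a, b) ≠ (4, 4) then t ≥ 20, and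
-- cruder bounds suffice.  The Cantor set is nevertheless thick enough for Hall's argument, carried
-- out for products: of two intervals, split the one with the (multiplicatively) larger gap.  The
-- other interval bridges this gap, and both parts are at least as large as it, so the invariant
-- persists and the intervals shrink to a representation of t.
--
-- Since ρ is a limit superior, it suffices to concatenate finite blocks whose central products
-- approximate t better and better.

module Submission where

open import Data.Bool.Base using (Bool; true; false; not; if_then_else_)
open import Data.Empty using (⊥; ⊥-elim)
open import Data.Integer.Base as ℤ using (ℤ; +_; 0ℤ)
import Data.Integer.Properties as ℤₚ
import Data.Integer.Solver as ℤ-Solver
open import Data.List.Base as List
  using (List; []; _∷_; _++_; _∷ʳ_; length; map; reverse; applyDownFrom)
import Data.List.Properties as Listₚ
open import Data.List.Relation.Unary.All using (All; []; _∷_)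
import Data.List.Relation.Unary.All.Properties as All
open import Data.Nat.Base as ℕ using (ℕ; zero; suc; z≤n; s≤s)
import Data.Nat.Properties as ℕₚ
import Data.Nat.Solver as ℕ-Solver
open import Data.Product.Base using (∃; ∃₂; _×_; _,_; proj₁; proj₂)
open import Data.Rational.Base
  using ( ℚ; mkℚ; 0ℚ; 1ℚ; ½; ∣_∣; 1/_; _/_; _+_; _*_; _-_; -_; _≤_; _<_; _⊔_; positive; nonNegative
        ; ≢-nonZero; toℚᵘ; ↥_; ↧_; ↧ₙ_)
open import Data.Rational.Properties
open import Data.Rational.Solver using (module +-*-Solver)
import Data.Rational.Unnormalised.Base as ℚᵘ
import Data.Rational.Unnormalised.Properties as ℚᵘₚ
open import Data.Sum.Base using (_⊎_; inj₁; inj₂)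
open import Data.Unit.Base using (⊤; tt)
open import Defs using
  ( ℝ; seq; cauchy; fromℚ; inv; 1/suc; archimedean; ⟦_⟧; convergent; RegularCF; mkCF; quotient
  ; quotient-positive; value; tailFrom; reversed; Irrational; Ω̄; μ; _≤ᵘ_; √_; isqrt; √-seq
  ; 0≤1; 0≤inv; *-inv; inv≤1; 1≤int; ≤+nonNeg; *-nonNeg; /-mono-≤; /-mono-<; two-steps
  ; 0<½ε; small-factor; ½*1/suc≤; 1/suc-antimono; ∣p-q∣≤; 1≤convergent; convergent-upper; isqrt-upper; /-suc)
open import Function.Base using (_∘_)
open import Relation.Binary.PropositionalEquality
  using (_≡_; refl; sym; trans; cong; cong₂; subst; subst₂; module ≡-Reasoning)
open import Relation.Nullary using (¬_; yes; Dec)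
open import Relation.Nullary.Decidable using (from-yes; _×-dec_)

-- Continued fractions as Möbius maps

-- The obstacle is that ratios of endpoints are not invariant under τ ↦ [d₁; ..., dₖ, τ], so the
-- thickness conditions would have to be checked behind every prefix. They reduce to a finite table.
-- The map is (pτ + p′)/(qτ + q′), and comparing two ratios of endpoints amounts to comparing the
-- values of one function at p′/p and at q′/q, which lie in [0, 1] for nonempty words. Whether that
-- function is monotone depends on the four endpoints only, hence on the state reached and not on
-- the prefix. Hulls with rational endpoints slightly inside the true ones keep the table decidable:
-- gaps are overestimated, and the parts of a hull need only be contained in the hulls of the
-- children. The bisection alone would reach every t ≥ (4 + 24/91)² ≈ 18.18; the larger threshold is
-- needed only to control the products at the other positions. All estimates on a block are uniform
-- in the unknown values σ, τ ≥ 1 beyond its delimiters, so that blocks do not interact.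

⌜_⌝ : ℕ → ℚ
⌜ d ⌝ = + d / 1

⌜⌝-mono : ∀ {m n} → m ℕ.≤ n → ⌜ m ⌝ ≤ ⌜ n ⌝
⌜⌝-mono {m} {n} m≤n = /-mono-≤ (+ m) 0 (+ n) 0
  (subst₂ ℤ._≤_ (sym (ℤₚ.*-identityʳ (+ m))) (sym (ℤₚ.*-identityʳ (+ n))) (ℤ.+≤+ m≤n))

module _ where

  open ℚᵘₚ.≃-Reasoning
  open ℤ-Solver.+-*-Solver

  /1-homo-+ : ∀ i j → (i ℤ.+ j) / 1 ≡ i / 1 + j / 1
  /1-homo-+ i j = toℚᵘ-injective (begin
    toℚᵘ ((i ℤ.+ j) / 1)                  ≈⟨ toℚᵘ-fromℚᵘ (ℚᵘ.mkℚᵘ (i ℤ.+ j) 0) ⟩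
    ℚᵘ.mkℚᵘ (i ℤ.+ j) 0                   ≈⟨ ℚᵘ.*≡* (numerators i j) ⟩
    ℚᵘ.mkℚᵘ i 0 ℚᵘ.+ ℚᵘ.mkℚᵘ j 0          ≈⟨ ℚᵘₚ.+-cong (toℚᵘ-fromℚᵘ (ℚᵘ.mkℚᵘ i 0)) (toℚᵘ-fromℚᵘ (ℚᵘ.mkℚᵘ j 0)) ⟨
    toℚᵘ (i / 1) ℚᵘ.+ toℚᵘ (j / 1)        ≈⟨ toℚᵘ-homo-+ (i / 1) (j / 1) ⟨
    toℚᵘ (i / 1 + j / 1)                  ∎)
    where
    numerators : ∀ i j → (i ℤ.+ j) ℤ.* + 1 ≡ (i ℤ.* + 1 ℤ.+ j ℤ.* + 1) ℤ.* + 1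
    numerators = solve 2 (λ i j →
      (i :+ j) :* con (+ 1) := (i :* con (+ 1) :+ j :* con (+ 1)) :* con (+ 1)) refl

  /1-homo-* : ∀ i j → (i ℤ.* j) / 1 ≡ i / 1 * (j / 1)
  /1-homo-* i j = toℚᵘ-injective (begin
    toℚᵘ ((i ℤ.* j) / 1)                  ≈⟨ toℚᵘ-fromℚᵘ (ℚᵘ.mkℚᵘ (i ℤ.* j) 0) ⟩
    ℚᵘ.mkℚᵘ (i ℤ.* j) 0                   ≈⟨ ℚᵘ.*≡* refl ⟩
    ℚᵘ.mkℚᵘ i 0 ℚᵘ.* ℚᵘ.mkℚᵘ j 0          ≈⟨ ℚᵘₚ.*-cong (toℚᵘ-fromℚᵘ (ℚᵘ.mkℚᵘ i 0)) (toℚᵘ-fromℚᵘ (ℚᵘ.mkℚᵘ j 0)) ⟨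
    toℚᵘ (i / 1) ℚᵘ.* toℚᵘ (j / 1)        ≈⟨ toℚᵘ-homo-* (i / 1) (j / 1) ⟨
    toℚᵘ (i / 1 * (j / 1))                ∎)

  *-denominator : ∀ r → r * (↧ r / 1) ≡ ↥ r / 1
  *-denominator r@(mkℚ n d _) = toℚᵘ-injective (begin
    toℚᵘ (r * (+ suc d / 1))              ≈⟨ toℚᵘ-homo-* r (+ suc d / 1) ⟩
    ℚᵘ.mkℚᵘ n d ℚᵘ.* toℚᵘ (+ suc d / 1)   ≈⟨ ℚᵘₚ.*-congˡ {ℚᵘ.mkℚᵘ n d} (toℚᵘ-fromℚᵘ (ℚᵘ.mkℚᵘ (+ suc d) 0)) ⟩
    ℚᵘ.mkℚᵘ n d ℚᵘ.* ℚᵘ.mkℚᵘ (+ suc d) 0  ≈⟨ ℚᵘ.*≡* numerators ⟩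
    ℚᵘ.mkℚᵘ n 0                           ≈⟨ toℚᵘ-fromℚᵘ (ℚᵘ.mkℚᵘ n 0) ⟨
    toℚᵘ (n / 1)                          ∎)
    where
    numerators : n ℤ.* + suc d ℤ.* + 1 ≡ n ℤ.* + suc (d ℕ.* 1)
    numerators = trans (ℤₚ.*-identityʳ (n ℤ.* + suc d))
      (cong (λ k → n ℤ.* + suc k) (sym (ℕₚ.*-identityʳ d)))

/1-mono : ∀ {i j} → i ℤ.≤ j → i / 1 ≤ j / 1
/1-mono {i} {j} i≤j = /-mono-≤ i 0 j 0
  (subst₂ ℤ._≤_ (sym (ℤₚ.*-identityʳ i)) (sym (ℤₚ.*-identityʳ j)) i≤j)

/1-cancel-< : ∀ {i j} → i / 1 < j / 1 → i ℤ.< j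
/1-cancel-< {i} {j} h = ℤₚ.≰⇒> λ j≤i → <-irrefl refl (<-≤-trans h (/1-mono j≤i))

0≤⌜⌝ : ∀ n → 0ℚ ≤ ⌜ n ⌝
0≤⌜⌝ n = ⌜⌝-mono {0} {n} z≤n

≤-by : ∀ {p q} d → 0ℚ ≤ d → q ≡ p + d → p ≤ q
≤-by {p} d 0≤d eq = subst (p ≤_) (sym eq) (≤+nonNeg 0≤d)

0≤- : ∀ {p q} → p ≤ q → 0ℚ ≤ q - p
0≤- {p} {q} p≤q = subst (_≤ q - p) (+-inverseʳ p) (+-monoˡ-≤ (- p) p≤q)

1≤⇒0< : ∀ {p} → 1ℚ ≤ p → 0ℚ < p
1≤⇒0< = <-≤-trans (positive⁻¹ 1ℚ)

1≤⇒0≤ : ∀ {p} → 1ℚ ≤ p → 0ℚ ≤ p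
1≤⇒0≤ = ≤-trans 0≤1

*-pos : ∀ {p q} → 0ℚ < p → 0ℚ < q → 0ℚ < p * q
*-pos {p} {q} 0<p 0<q = positive⁻¹ (p * q)
  {{pos*pos⇒pos p {{positive 0<p}} q {{positive 0<q}}}}

+-nonNeg : ∀ {p q} → 0ℚ ≤ p → 0ℚ ≤ q → 0ℚ ≤ p + q
+-nonNeg = +-mono-≤

*-monoˡ : ∀ {p q} r → 0ℚ ≤ r → p ≤ q → r * p ≤ r * q
*-monoˡ r 0≤r = *-monoˡ-≤-nonNeg r {{nonNegative 0≤r}}

*-monoʳ : ∀ {p q} r → 0ℚ ≤ r → p ≤ q → p * r ≤ q * r
*-monoʳ r 0≤r = *-monoʳ-≤-nonNeg r {{nonNegative 0≤r}}

*-mono : ∀ {p q r s} → 0ℚ ≤ r → 0ℚ ≤ q → p ≤ q → r ≤ s → p * r ≤ q * s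
*-mono {p} {q} {r} 0≤r 0≤q p≤q r≤s = ≤-trans (*-monoʳ r 0≤r p≤q) (*-monoˡ q 0≤q r≤s)

*-cancelʳ : ∀ {p q} r → 0ℚ < r → p * r ≤ q * r → p ≤ q
*-cancelʳ r 0<r = *-cancelʳ-≤-pos r {{positive 0<r}}

inv-antimono : ∀ {p q} → 1ℚ ≤ p → p ≤ q → inv q ≤ inv p
inv-antimono {p} {q} 1≤p p≤q = subst₂ _≤_ eq₁ eq₂
  (*-monoʳ (inv p * inv q) (*-nonNeg (0≤inv (1≤⇒0≤ 1≤p)) (0≤inv (1≤⇒0≤ 1≤q))) p≤q)
  where
  1≤q : 1ℚ ≤ q
  1≤q = ≤-trans 1≤p p≤q
  eq₁ : p * (inv p * inv q) ≡ inv q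
  eq₁ = trans (sym (*-assoc p (inv p) (inv q)))
    (trans (cong (_* inv q) (*-inv 1≤p)) (*-identityˡ (inv q)))
  eq₂ : q * (inv p * inv q) ≡ inv p
  eq₂ = trans (cong (q *_) (*-comm (inv p) (inv q))) (trans (sym (*-assoc q (inv q) (inv p)))
    (trans (cong (_* inv p) (*-inv 1≤q)) (*-identityˡ (inv p))))

*-inv-cancel : ∀ x {u} → 1ℚ ≤ u → x * inv u * u ≡ x
*-inv-cancel x {u} 1≤u = trans (*-assoc x (inv u) u)
  (trans (cong (x *_) (trans (*-comm (inv u) u) (*-inv 1≤u))) (*-identityʳ x))

inv-positive : ∀ {u} → 1ℚ ≤ u → 0ℚ < inv u
inv-positive {u} 1≤u = ≰⇒> λ inv≤0 → <-irrefl refl (<-≤-trans (positive⁻¹ 1ℚ)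
  (subst₂ _≤_ (*-inv 1≤u) (*-zeroʳ u) (*-monoˡ u (1≤⇒0≤ 1≤u) inv≤0)))

-- [d₁; d₂, …, dₖ, τ]
X : List ℕ → ℚ → ℚ
X []      τ = τ
X (d ∷ w) τ = ⌜ d ⌝ + inv (X w τ)

Digits : List ℕ → Set
Digits = All (1 ℕ.≤_)

1≤X : ∀ {w τ} → Digits w → 1ℚ ≤ τ → 1ℚ ≤ X w τ
1≤X []         1≤τ = 1≤τ
1≤X (d⁺ ∷ w⁺) 1≤τ = ≤-trans (⌜⌝-mono d⁺) (≤+nonNeg (0≤inv (1≤⇒0≤ (1≤X w⁺ 1≤τ))))

X-++ : ∀ v w τ → X (v ++ w) τ ≡ X v (X w τ)
X-++ []      w τ = refl
X-++ (d ∷ v) w τ = cong (λ x → ⌜ d ⌝ + inv x) (X-++ v w τ)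

-- The entries of the product of the matrices (d 1; 1 0) over the word: X w τ = (p τ + p′) / (q τ +
-- q′).
p p′ q q′ : List ℕ → ℚ
p []       = 1ℚ
p (d ∷ w)  = ⌜ d ⌝ * p w + q w
p′ []      = 0ℚ
p′ (d ∷ w) = ⌜ d ⌝ * p′ w + q′ w
q []       = 0ℚ
q (d ∷ w)  = p w
q′ []      = 1ℚ
q′ (d ∷ w) = p′ w

-- The two are mutual: the denominator of d ∷ w is the numerator of w, that is, X w τ times the
-- denominator of w.
denominator-positive : ∀ {w τ} → Digits w → 1ℚ ≤ τ → 0ℚ < q w * τ + q′ w
numerator : ∀ {w τ} → Digits w → 1ℚ ≤ τ → X w τ * (q w * τ + q′ w) ≡ p w * τ + p′ w

denominator-positive {_} {τ} []         1≤τ = subst (0ℚ <_) (eq τ) (positive⁻¹ 1ℚ)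
  where
  open +-*-Solver
  eq : ∀ τ → 1ℚ ≡ 0ℚ * τ + 1ℚ
  eq = solve 1 (λ τ → con 1ℚ := con 0ℚ :* τ :+ con 1ℚ) refl
denominator-positive (_ ∷ w⁺) 1≤τ = subst (0ℚ <_) (numerator w⁺ 1≤τ)
  (*-pos (1≤⇒0< (1≤X w⁺ 1≤τ)) (denominator-positive w⁺ 1≤τ))

numerator {_} {τ} [] 1≤τ = solve 1
  (λ τ → τ :* (con 0ℚ :* τ :+ con 1ℚ) := con 1ℚ :* τ :+ con 0ℚ) refl τ
  where open +-*-Solver
numerator {d ∷ w} {τ} (_ ∷ w⁺) 1≤τ = begin
  (D + inv x) * (p w * τ + p′ w)              ≡⟨ cong ((D + inv x) *_) (numerator w⁺ 1≤τ) ⟨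
  (D + inv x) * (x * (q w * τ + q′ w))        ≡⟨ expand D x (inv x) (q w * τ + q′ w) ⟩
  D * (x * (q w * τ + q′ w)) + (x * inv x) * (q w * τ + q′ w)
    ≡⟨ cong₂ (λ y z → D * y + z * (q w * τ + q′ w)) (numerator w⁺ 1≤τ) (*-inv (1≤X w⁺ 1≤τ)) ⟩
  D * (p w * τ + p′ w) + 1ℚ * (q w * τ + q′ w) ≡⟨ collect D (p w) (p′ w) (q w) (q′ w) τ ⟩
  (D * p w + q w) * τ + (D * p′ w + q′ w)     ∎
  where
  open ≡-Reasoning
  open +-*-Solver
  D = ⌜ d ⌝
  x = X w τ
  expand : ∀ D x y c → (D + y) * (x * c) ≡ D * (x * c) + (x * y) * c
  expand = solve 4 (λ D x y c → (D :+ y) :* (x :* c) := D :* (x :* c) :+ (x :* y) :* c) refl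
  collect : ∀ D a a′ b b′ τ → D * (a * τ + a′) + 1ℚ * (b * τ + b′) ≡ (D * a + b) * τ + (D * a′ + b′)
  collect = solve 6 (λ D a a′ b b′ τ →
    D :* (a :* τ :+ a′) :+ con 1ℚ :* (b :* τ :+ b′) := (D :* a :+ b) :* τ :+ (D :* a′ :+ b′)) refl

increasing : List ℕ → Bool
increasing []      = true
increasing (_ ∷ w) = not (increasing w)

sign : Bool → ℚ
sign true  = 1ℚ
sign false = - 1ℚ

sign-not : ∀ b → sign (not b) ≡ - sign b
sign-not true  = refl
sign-not false = refl

determinant : ∀ w → p w * q′ w - p′ w * q w ≡ sign (increasing w)
determinant []      = refl
determinant (d ∷ w) = trans (eq ⌜ d ⌝ (p w) (p′ w) (q w) (q′ w))
  (trans (cong -_ (determinant w)) (sym (sign-not (increasing w))))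
  where
  open +-*-Solver
  eq : ∀ D a a′ b b′ → (D * a + b) * a′ - (D * a′ + b′) * a ≡ - (a * b′ - a′ * b)
  eq = solve 5 (λ D a a′ b b′ → (D :* a :+ b) :* a′ :- (D :* a′ :+ b′) :* a := :- (a :* b′ :- a′ :* b)) refl

-- Places p′/p and q′/q in [0, 1]. The word must be nonempty: for [] one has q = 0 and q′ = 1.
coefficients : ∀ d {w} → Digits (d ∷ w) →
  (0ℚ ≤ p′ (d ∷ w) × p′ (d ∷ w) ≤ p (d ∷ w)) × (0ℚ ≤ q′ (d ∷ w) × q′ (d ∷ w) ≤ q (d ∷ w))
coefficients d {[]} (d⁺ ∷ []) =
  (subst (0ℚ ≤_) (sym eq′) 0≤1 , subst₂ _≤_ (sym eq′) (sym eq) (⌜⌝-mono d⁺)) , (≤-refl , 0≤1)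
  where
  eq : ⌜ d ⌝ * 1ℚ + 0ℚ ≡ ⌜ d ⌝
  eq = trans (+-identityʳ (⌜ d ⌝ * 1ℚ)) (*-identityʳ ⌜ d ⌝)
  eq′ : ⌜ d ⌝ * 0ℚ + 1ℚ ≡ 1ℚ
  eq′ = trans (cong (_+ 1ℚ) (*-zeroʳ ⌜ d ⌝)) (+-identityˡ 1ℚ)
coefficients d {e ∷ w} (d⁺ ∷ w⁺) with coefficients e w⁺
... | (0≤p′ , p′≤p) , (0≤q′ , q′≤q) =
  ( +-nonNeg (*-nonNeg (0≤⌜⌝ d) 0≤p′) 0≤q′
  , +-mono-≤ (*-monoˡ ⌜ d ⌝ (0≤⌜⌝ d) p′≤p) q′≤q) , (0≤p′ , p′≤p)

-- Comparing ratios of endpoints under Möbius maps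

Interval : Set
Interval = ℚ × ℚ

infix 4 _⊑_ _⊆ᴵ_

-- I ⊑ J compares the ratios of the endpoints of two positive intervals: v / u ≤ d / c.
_⊑_ : Interval → Interval → Set
(u , v) ⊑ (c , d) = v * c ≤ u * d

_⊆ᴵ_ : Interval → Interval → Set
(u , v) ⊆ᴵ (c , d) = c ≤ u × v ≤ d

-- These inequalities make (α + s₂)(α + s₃) / ((α + s₁)(α + s₄)) nondecreasing in α ∈ [0, 1].
Dominated : Interval → Interval → Set
Dominated (s₁ , s₂) (s₃ , s₄) =
  s₂ * s₃ ≤ s₁ * s₄ ×
  (s₂ * s₃) * (s₁ + s₄) ≤ (s₂ + s₃) * (s₁ * s₄) ×
  (s₂ * s₃) * (s₁ + s₄) + (s₂ + s₃) ≤ (s₂ + s₃) * (s₁ * s₄) + (s₁ + s₄)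

dominated? : ∀ I J → Dec (Dominated I J)
dominated? _ _ = (_ ≤? _) ×-dec (_ ≤? _) ×-dec (_ ≤? _)

orient : Bool → Interval → Interval
orient true  (x , y) = x , y
orient false (x , y) = y , x

X-image : List ℕ → Interval → Interval
X-image w (x , y) = orient (increasing w) (X w x , X w y)

Above-1 : Interval → Set
Above-1 (x , y) = 1ℚ ≤ x × 1ℚ ≤ y

cross-multiply : ∀ {x₁ x₂ x₃ x₄ d₁ d₂ d₃ d₄} →
  0ℚ < d₁ → 0ℚ < d₂ → 0ℚ < d₃ → 0ℚ < d₄ →
  (x₂ * d₂) * (x₃ * d₃) * (d₁ * d₄) ≤ (x₁ * d₁) * (x₄ * d₄) * (d₂ * d₃) →
  x₂ * x₃ ≤ x₁ * x₄
cross-multiply {x₁} {x₂} {x₃} {x₄} {d₁} {d₂} {d₃} {d₄} 0<d₁ 0<d₂ 0<d₃ 0<d₄ h =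
  *-cancelʳ ((d₁ * d₄) * (d₂ * d₃)) (*-pos (*-pos 0<d₁ 0<d₄) (*-pos 0<d₂ 0<d₃))
    (subst₂ _≤_
      (solve 6 (λ x₂ x₃ d₁ d₂ d₃ d₄ →
        (x₂ :* d₂) :* (x₃ :* d₃) :* (d₁ :* d₄) := x₂ :* x₃ :* ((d₁ :* d₄) :* (d₂ :* d₃)))
        refl x₂ x₃ d₁ d₂ d₃ d₄)
      (solve 6 (λ x₁ x₄ d₁ d₂ d₃ d₄ →
        (x₁ :* d₁) :* (x₄ :* d₄) :* (d₂ :* d₃) := x₁ :* x₄ :* ((d₁ :* d₄) :* (d₂ :* d₃)))
        refl x₁ x₄ d₁ d₂ d₃ d₄)
      h)
  where open +-*-Solver

module _ (a a′ b b′ s₁ s₂ s₃ s₄ : ℚ) where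

  -- Nᵢ and Dᵢ are the numerator and the denominator at sᵢ. `E` is the numerator of the derivative
  -- of the function behind `Dominated`, polarised in a′/a and b′/b. It is grouped so that each
  -- inequality of `Dominated` is multiplied by one of a′b′, ab′ + a′b and ab - a′b′, all
  -- nonnegative when a′ ≤ a and b′ ≤ b.
  N₂N₃D₁D₄ N₁N₄D₂D₃ E : ℚ
  N₂N₃D₁D₄ = (a * s₂ + a′) * (a * s₃ + a′) * ((b * s₁ + b′) * (b * s₄ + b′))
  N₁N₄D₂D₃ = (a * s₁ + a′) * (a * s₄ + a′) * ((b * s₂ + b′) * (b * s₃ + b′))
  E = a′ * b′ * (((s₂ + s₃) * (s₁ * s₄) + (s₁ + s₄)) - ((s₂ * s₃) * (s₁ + s₄) + (s₂ + s₃)))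
    + (a * b′ + a′ * b) * (s₁ * s₄ - s₂ * s₃)
    + (a * b - a′ * b′) * ((s₂ + s₃) * (s₁ * s₄) - (s₂ * s₃) * (s₁ + s₄))

  -- The two products are bihomogeneous quadratic forms, and their difference is divisible
  -- by the determinant.
  difference : N₁N₄D₂D₃ ≡ N₂N₃D₁D₄ + (a * b′ - a′ * b) * E
  difference = solve 8 (λ a a′ b b′ s₁ s₂ s₃ s₄ →
    (a :* s₁ :+ a′) :* (a :* s₄ :+ a′) :* ((b :* s₂ :+ b′) :* (b :* s₃ :+ b′)) :=
    (a :* s₂ :+ a′) :* (a :* s₃ :+ a′) :* ((b :* s₁ :+ b′) :* (b :* s₄ :+ b′)) :+
    (a :* b′ :- a′ :* b) :*
    (a′ :* b′ :* (((s₂ :+ s₃) :* (s₁ :* s₄) :+ (s₁ :+ s₄)) :- ((s₂ :* s₃) :* (s₁ :+ s₄) :+ (s₂ :+ s₃)))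
    :+ (a :* b′ :+ a′ :* b) :* (s₁ :* s₄ :- s₂ :* s₃)
    :+ (a :* b :- a′ :* b′) :* ((s₂ :+ s₃) :* (s₁ :* s₄) :- (s₂ :* s₃) :* (s₁ :+ s₄)))) refl
    a a′ b b′ s₁ s₂ s₃ s₄
    where open +-*-Solver

  0≤E : Dominated (s₁ , s₂) (s₃ , s₄) →
    0ℚ ≤ a′ × a′ ≤ a → 0ℚ ≤ b′ × b′ ≤ b → 0ℚ ≤ E
  0≤E (h₁ , h₂ , h₃) (0≤a′ , a′≤a) (0≤b′ , b′≤b) = +-nonNeg (+-nonNeg
    (*-nonNeg (*-nonNeg 0≤a′ 0≤b′) (0≤- h₃))
    (*-nonNeg (+-nonNeg (*-nonNeg 0≤a 0≤b′) (*-nonNeg 0≤a′ 0≤b)) (0≤- h₁)))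
    (*-nonNeg (0≤- (*-mono 0≤b′ 0≤a a′≤a b′≤b)) (0≤- h₂))
    where
    0≤a = ≤-trans 0≤a′ a′≤a
    0≤b = ≤-trans 0≤b′ b′≤b

-- With f the function behind `Dominated`, X s₂ · X s₃ / (X s₁ · X s₄) = f(p′/p) / f(q′/q). The
-- determinant has the sign of q′/q - p′/p and also decides whether X preserves or reverses order,
-- so a nondecreasing f gives the required inequality in both orientations.
X-image-⊑ : ∀ {d w I J} → Digits (d ∷ w) → Above-1 I → Above-1 J →
  Dominated I J → X-image (d ∷ w) I ⊑ X-image (d ∷ w) J
X-image-⊑ {d} {w′} {s₁ , s₂} {s₃ , s₄} w⁺ (1≤s₁ , 1≤s₂) (1≤s₃ , 1≤s₄) dom =
  go (increasing w) (determinant w)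
  where
  w = d ∷ w′
  D : ℚ → ℚ
  D s = q w * s + q′ w
  0≤e = 0≤E (p w) (p′ w) (q w) (q′ w) s₁ s₂ s₃ s₄ dom (proj₁ (coefficients d w⁺)) (proj₂ (coefficients d w⁺))
  e = E (p w) (p′ w) (q w) (q′ w) s₁ s₂ s₃ s₄
  A = N₂N₃D₁D₄ (p w) (p′ w) (q w) (q′ w) s₁ s₂ s₃ s₄
  diff = difference (p w) (p′ w) (q w) (q′ w) s₁ s₂ s₃ s₄

  fractions : ∀ {x₁ x₂ x₃ x₄} → 1ℚ ≤ x₁ → 1ℚ ≤ x₂ → 1ℚ ≤ x₃ → 1ℚ ≤ x₄ →
    (p w * x₂ + p′ w) * (p w * x₃ + p′ w) * (D x₁ * D x₄) ≤
    (p w * x₁ + p′ w) * (p w * x₄ + p′ w) * (D x₂ * D x₃) →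
    X w x₂ * X w x₃ ≤ X w x₁ * X w x₄
  fractions {x₁} {x₂} {x₃} {x₄} 1≤x₁ 1≤x₂ 1≤x₃ 1≤x₄ h = cross-multiply {X w x₁} {X w x₂} {X w x₃} {X w x₄}
    (denominator-positive w⁺ 1≤x₁) (denominator-positive w⁺ 1≤x₂)
    (denominator-positive w⁺ 1≤x₃) (denominator-positive w⁺ 1≤x₄)
    (subst₂ _≤_
      (cong (_* (D x₁ * D x₄)) (sym (cong₂ _*_ (numerator w⁺ 1≤x₂) (numerator w⁺ 1≤x₃))))
      (cong (_* (D x₂ * D x₃)) (sym (cong₂ _*_ (numerator w⁺ 1≤x₁) (numerator w⁺ 1≤x₄))))
      h)

  go : ∀ b → p w * q′ w - p′ w * q w ≡ sign b →
    orient b (X w s₁ , X w s₂) ⊑ orient b (X w s₃ , X w s₄)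
  go true  det = fractions 1≤s₁ 1≤s₂ 1≤s₃ 1≤s₄
    (≤-by e 0≤e (trans diff (cong (λ z → A + z) (trans (cong (_* e) det) (*-identityˡ e)))))
  go false det = fractions 1≤s₂ 1≤s₁ 1≤s₄ 1≤s₃
    (≤-by e 0≤e (trans (sym (cancel A e)) (cong (_+ e) (sym (trans diff
      (cong (λ z → A + z) (trans (cong (_* e) det) (sym (neg-distribˡ-* 1ℚ e)))))))))
    where
    open +-*-Solver
    cancel : ∀ A e → A + - (1ℚ * e) + e ≡ A
    cancel = solve 2 (λ A e → A :+ :- (con 1ℚ :* e) :+ e := A) refl

Directed : Bool → ℚ → ℚ → Set
Directed true  x y = x ≤ y
Directed false x y = y ≤ x

X-directed : ∀ w {x y} → Digits w → 1ℚ ≤ x → x ≤ y → Directed (increasing w) (X w x) (X w y)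
X-directed []      _         _   x≤y = x≤y
X-directed (d ∷ w) {x} {y} (_ ∷ w⁺) 1≤x x≤y =
  go (increasing w) (1≤X w⁺ 1≤x) (1≤X w⁺ (≤-trans 1≤x x≤y)) (X-directed w w⁺ 1≤x x≤y)
  where
  go : ∀ b {u v} → 1ℚ ≤ u → 1ℚ ≤ v → Directed b u v →
    Directed (not b) (⌜ d ⌝ + inv u) (⌜ d ⌝ + inv v)
  go true  1≤u 1≤v u≤v = +-monoʳ-≤ ⌜ d ⌝ (inv-antimono 1≤u u≤v)
  go false 1≤u 1≤v v≤u = +-monoʳ-≤ ⌜ d ⌝ (inv-antimono 1≤v v≤u)

X-image-⊆ : ∀ w {x₁ y₁ x₂ y₂} → Digits w → 1ℚ ≤ x₁ → 1ℚ ≤ x₂ → 1ℚ ≤ y₁ →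
  (x₁ , y₁) ⊆ᴵ (x₂ , y₂) → X-image w (x₁ , y₁) ⊆ᴵ X-image w (x₂ , y₂)
X-image-⊆ w w⁺ 1≤x₁ 1≤x₂ 1≤y₁ (x₂≤x₁ , y₁≤y₂) =
  go (increasing w) (X-directed w w⁺ 1≤x₂ x₂≤x₁) (X-directed w w⁺ 1≤y₁ y₁≤y₂)
  where
  go : ∀ b {u₁ v₁ u₂ v₂} → Directed b u₂ u₁ → Directed b v₁ v₂ →
    orient b (u₁ , v₁) ⊆ᴵ orient b (u₂ , v₂)
  go true  l r = l , r
  go false l r = r , l

increasing-∷ʳ : ∀ w d → increasing (w ∷ʳ d) ≡ not (increasing w)
increasing-∷ʳ []      d = refl
increasing-∷ʳ (_ ∷ w) d = cong not (increasing-∷ʳ w d)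

prepend : ℕ → Interval → Interval
prepend d (x , y) = ⌜ d ⌝ + inv y , ⌜ d ⌝ + inv x

X-image-∷ʳ : ∀ w d I → X-image (w ∷ʳ d) I ≡ X-image w (prepend d I)
X-image-∷ʳ w d (x , y) rewrite increasing-∷ʳ w d | X-++ w (d ∷ []) x | X-++ w (d ∷ []) y
  with increasing w
... | true  = refl
... | false = refl

-- The subshift and its hulls

data State : Set where
  free after-4 after-41 after-43 restricted : State

-- A word is read outwards from the centre; it avoids 44, 4134 and 4314.
top-1 : State → ℕ
top-1 free       = 3
top-1 after-4    = 2
top-1 after-41   = 3
top-1 after-43   = 3
top-1 restricted = 2

-- `restricted` is reached after 413 and 431, where a 4 would complete a forbidden word. The digit
-- accepted next is at most 3, so no forbidden word is then in progress and the state is `free`.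
step : State → ℕ → State
step restricted _ = free
step after-4    1 = after-41
step after-4    3 = after-43
step after-41   3 = restricted
step after-43   1 = restricted
step _          4 = after-4
step _          _ = free

top-1≤3 : ∀ s → top-1 s ℕ.≤ 3
top-1≤3 free       = ℕₚ.≤-refl
top-1≤3 after-4    = ℕₚ.n≤1+n 2
top-1≤3 after-41   = ℕₚ.≤-refl
top-1≤3 after-43   = ℕₚ.≤-refl
top-1≤3 restricted = ℕₚ.n≤1+n 2

step-4 : ∀ s → 4 ℕ.≤ suc (top-1 s) → step s 4 ≡ after-4
step-4 free     _ = refl
step-4 after-41 _ = refl
step-4 after-43 _ = refl
step-4 after-4    (s≤s (s≤s (s≤s ())))
step-4 restricted (s≤s (s≤s (s≤s ())))

run : State → List ℕ → State
run s []      = s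
run s (d ∷ w) = run (step s d) w

Accepts : State → List ℕ → Set
Accepts s []      = ⊤
Accepts s (d ∷ w) = (1 ℕ.≤ d × d ℕ.≤ suc (top-1 s)) × Accepts (step s d) w

accepts? : ∀ s w → Dec (Accepts s w)
accepts? s []      = yes tt
accepts? s (d ∷ w) = ((1 ℕₚ.≤? d) ×-dec (d ℕₚ.≤? suc (top-1 s))) ×-dec accepts? (step s d) w

accepts⇒digits : ∀ s {w} → Accepts s w → Digits w
accepts⇒digits s {[]}    _               = []
accepts⇒digits s {d ∷ _} ((1≤d , _) , h) = 1≤d ∷ accepts⇒digits (step s d) h

accepts-++ : ∀ s v {w} → Accepts s v → Accepts (run s v) w → Accepts s (v ++ w)
accepts-++ s []      _        h′ = h′
accepts-++ s (d ∷ v) (d≤ , h) h′ = d≤ , accepts-++ (step s d) v h h′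

run-++ : ∀ s v w → run s (v ++ w) ≡ run (run s v) w
run-++ s []      w = refl
run-++ s (d ∷ v) w = run-++ (step s d) v w

-- Rational approximations, from inside, of the hull of the tails [d₁; d₂, …] accepted from
-- a state.
low high : State → ℚ
-- The values are extremal tails cut off after a final 1, 4: 24/19 = [1; 3, 1, 4], 29/24 =
-- [1; 4, 1, 4], 91/24 = [3; 1, 3, 1, 4], 19/5 = [3; 1, 4] and 24/5 = [4; 1, 4].
low after-43 = + 24 / 19
low _        = + 29 / 24
high after-4    = + 91 / 24
high restricted = + 19 / 5
high _          = + 24 / 5

first : State → ℕ → ℚ
first s zero      = low s
first s d@(suc _) = ⌜ suc d ⌝ + inv (high (step s (suc d)))

-- The tails whose first digit is at least suc i, and the gap between those with first digit
-- suc i and the others.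
hull gap : State → ℕ → Interval
hull s i = first s i , high s
gap  s i = ⌜ suc i ⌝ + inv (low (step s (suc i))) , first s (suc i)

smaller-digit larger-digits : State → ℕ → Interval
smaller-digit s i = first s i , proj₁ (gap s i)
larger-digits s i = proj₂ (gap s i) , high s

prepends : List ℕ → Interval → Interval
prepends []      I = I
prepends (d ∷ w) I = prepend d (prepends w I)

X-image-++ : ∀ w v I → X-image (w ++ v) I ≡ X-image w (prepends v I)
X-image-++ w []      I = cong (λ w → X-image w I) (Listₚ.++-identityʳ w)
X-image-++ w (d ∷ v) I = trans (cong (λ w → X-image w I) (sym (Listₚ.++-assoc w (d ∷ []) v)))
  (trans (X-image-++ (w ∷ʳ d) v I) (X-image-∷ʳ w d (prepends v I)))

-- A child is given by the digits to append and the new index. If a single larger digit remains, no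
-- gap is left at this level and that digit is appended.
smaller-child larger-child : State → ℕ → List ℕ × ℕ
smaller-child s i = suc i ∷ [] , 0
larger-child  s i = if suc i ℕ.<ᵇ top-1 s then ([] , suc i) else (suc (suc i) ∷ [] , 0)

module _ (s : State) (i : ℕ) where

  -- The comparisons of gaps and hulls are stated as `Dominated` rather than `⊑` because only the
  -- former carries over to the images under every prefix.
  Child : Interval → List ℕ × ℕ → Set
  Child J (v , j) =
    (Accepts s v × j ℕ.< top-1 (run s v) × i ℕ.< 3 ℕ.* length v ℕ.+ j) ×
    (proj₁ I ≤ proj₁ J × proj₂ J ≤ proj₂ I) ×
    Dominated (gap s i) I × Dominated G (gap s i) ×
    (1ℚ ≤ proj₁ I × 1ℚ ≤ proj₂ I) × (1ℚ ≤ proj₁ G × 1ℚ ≤ proj₂ G)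
    where
    I = prepends v (hull (run s v) j)
    G = prepends v (gap (run s v) j)

  child? : ∀ J c → Dec (Child J c)
  child? J (v , j) =
    (accepts? s v ×-dec (_ ℕₚ.≤? _) ×-dec (_ ℕₚ.≤? _)) ×-dec ((_ ≤? _) ×-dec (_ ≤? _)) ×-dec
    dominated? (gap s i) I ×-dec dominated? G (gap s i) ×-dec
    ((_ ≤? _) ×-dec (_ ≤? _)) ×-dec ((_ ≤? _) ×-dec (_ ≤? _))
    where
    I = prepends v (hull (run s v) j)
    G = prepends v (gap (run s v) j)

  Splits : Set
  Splits =
    (1ℚ ≤ first s i × 1ℚ ≤ high s) × (1ℚ ≤ proj₁ (gap s i) × 1ℚ ≤ proj₂ (gap s i)) ×
    proj₁ (gap s i) < proj₂ (gap s i) ×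
    Child (smaller-digit s i) (smaller-child s i) × Child (larger-digits s i) (larger-child s i)

  splits? : Dec Splits
  splits? = ((_ ≤? _) ×-dec (_ ≤? _)) ×-dec ((_ ≤? _) ×-dec (_ ≤? _)) ×-dec (_ <? _) ×-dec
    child? (smaller-digit s i) (smaller-child s i) ×-dec child? (larger-digits s i) (larger-child s i)

opaque
  -- A rational computation for 13 pairs of a state and an index, kept opaque so that it is not
  -- repeated at each use.
  splits : ∀ s {i} → i ℕ.< top-1 s → Splits s i
  splits free       = from-yes (ℕₚ.allUpTo? (splits? free) 3)
  splits after-4    = from-yes (ℕₚ.allUpTo? (splits? after-4) 2)
  splits after-41   = from-yes (ℕₚ.allUpTo? (splits? after-41) 3)
  splits after-43   = from-yes (ℕₚ.allUpTo? (splits? after-43) 3)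
  splits restricted = from-yes (ℕₚ.allUpTo? (splits? restricted) 2)

-- The word starts in `after-4` because the centre digit next to it is treated like a 4 even when it
-- is larger. As the index is less than 3, `size` orders nodes lexicographically: it grows at every
-- split, and a large size forces a long word.
record Node : Set where
  field
    word     : List ℕ
    accepted : Accepts after-4 word
    index    : ℕ
    index<   : index ℕ.< top-1 (run after-4 word)

  state : State
  state = run after-4 word

  size : ℕ
  size = 3 ℕ.* length word ℕ.+ index

open Node public

node-hull node-gap : ℕ → Node → Interval
node-hull a P = X-image (a ∷ word P) (hull (state P) (index P))
node-gap  a P = X-image (a ∷ word P) (gap (state P) (index P))

centred-digits : ∀ {a} → 1 ℕ.≤ a → ∀ P → Digits (a ∷ word P)
centred-digits 1≤a P = 1≤a ∷ accepts⇒digits after-4 (accepted P)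

record Part (a : ℕ) (P C : Node) (J : Interval) : Set where
  field
    larger : size P ℕ.< size C
    covers : J ⊆ᴵ node-hull a C
    gap⊑hull : node-gap a P ⊑ node-hull a C
    gap⊑gap  : node-gap a C ⊑ node-gap a P

open Part public

part : ∀ {a} → 1 ℕ.≤ a → ∀ P {J} c → Above-1 J → Child (state P) (index P) J c →
  ∃ λ C → Part a P C (X-image (a ∷ word P) J)
part {a} 1≤a P {J} (v , j) (1≤J₁ , 1≤J₂) ((acc , j< , i<) , J⊆ , dom , dom′ , 1≤hull , 1≤gap) = C , record
  { larger   = larger′
  ; covers   = subst (X-image (a ∷ word P) J ⊆ᴵ_) (sym hull≡)
      (X-image-⊆ (a ∷ word P) w⁺ 1≤J₁ (proj₁ 1≤hull) 1≤J₂ J⊆)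
  ; gap⊑hull = subst (node-gap a P ⊑_) (sym hull≡) (X-image-⊑ w⁺ 1≤gapP 1≤hull dom)
  ; gap⊑gap  = subst (_⊑ node-gap a P) (sym gap≡) (X-image-⊑ w⁺ 1≤gap 1≤gapP dom′)
  }
  where
  w⁺ = centred-digits 1≤a P
  1≤gapP = proj₁ (proj₂ (splits (state P) (index< P)))
  C : Node
  C = record
    { word     = word P ++ v
    ; accepted = accepts-++ after-4 (word P) (accepted P) acc
    ; index    = j
    ; index<   = subst (λ s → j ℕ.< top-1 s) (sym (run-++ after-4 (word P) v)) j<
    }
  hull≡ : node-hull a C ≡ X-image (a ∷ word P) (prepends v (hull (run (state P) v) j))
  hull≡ = trans (X-image-++ (a ∷ word P) v _)
    (cong (λ s → X-image (a ∷ word P) (prepends v (hull s j))) (run-++ after-4 (word P) v))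
  gap≡ : node-gap a C ≡ X-image (a ∷ word P) (prepends v (gap (run (state P) v) j))
  gap≡ = trans (X-image-++ (a ∷ word P) v _)
    (cong (λ s → X-image (a ∷ word P) (prepends v (gap s j))) (run-++ after-4 (word P) v))
  larger′ : size P ℕ.< size C
  larger′ = begin-strict
    3 ℕ.* m ℕ.+ index P                       <⟨ ℕₚ.+-monoʳ-< _ i< ⟩
    3 ℕ.* m ℕ.+ (3 ℕ.* length v ℕ.+ j)        ≡⟨ ℕₚ.+-assoc (3 ℕ.* m) (3 ℕ.* length v) j ⟨
    3 ℕ.* m ℕ.+ 3 ℕ.* length v ℕ.+ j          ≡⟨ cong (ℕ._+ j) (ℕₚ.*-distribˡ-+ 3 m (length v)) ⟨
    3 ℕ.* (m ℕ.+ length v) ℕ.+ j              ≡⟨ cong (λ n → 3 ℕ.* n ℕ.+ j) (Listₚ.length-++ (word P)) ⟨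
    3 ℕ.* length (word P ++ v) ℕ.+ j          ∎
    where
    open ℕₚ.≤-Reasoning
    m = length (word P)

record Split (a : ℕ) (P : Node) : Set where
  field
    below above : Node
    below-part  : Part a P below (proj₁ (node-hull a P) , proj₁ (node-gap a P))
    above-part  : Part a P above (proj₂ (node-gap a P) , proj₂ (node-hull a P))

open Split public

-- If the prefix reverses order, the child with the smaller digit is the upper part.
split : ∀ {a} → 1 ℕ.≤ a → ∀ P → Split a P
split {a} 1≤a P = go (increasing (a ∷ word P)) (proj₂ smaller) (proj₂ larger-part) refl
  where
  s = state P
  i = index P
  table = splits s (index< P)
  1≤hull = proj₁ table
  1≤gap = proj₁ (proj₂ table)
  smaller = part 1≤a P (smaller-child s i) (proj₁ 1≤hull , proj₁ 1≤gap)
    (proj₁ (proj₂ (proj₂ (proj₂ table))))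
  larger-part = part 1≤a P (larger-child s i) (proj₂ 1≤gap , proj₂ 1≤hull)
    (proj₂ (proj₂ (proj₂ (proj₂ table))))
  image : Bool → Interval → Interval
  image b (x , y) = orient b (X (a ∷ word P) x , X (a ∷ word P) y)
  low-end high-end : Bool → Interval
  low-end  b = proj₁ (image b (hull s i)) , proj₁ (image b (gap s i))
  high-end b = proj₂ (image b (gap s i)) , proj₂ (image b (hull s i))
  go : ∀ b {C₁ C₂} → Part a P C₁ (image b (smaller-digit s i)) → Part a P C₂ (image b (larger-digits s i)) →
    increasing (a ∷ word P) ≡ b → Split a P
  go true  {C₁} {C₂} part₁ part₂ eq = record
    { below = C₁
    ; above = C₂
    ; below-part = subst (λ b → Part a P C₁ (low-end b)) (sym eq) part₁
    ; above-part = subst (λ b → Part a P C₂ (high-end b)) (sym eq) part₂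
    }
  go false {C₁} {C₂} part₁ part₂ eq = record
    { below = C₂
    ; above = C₁
    ; below-part = subst (λ b → Part a P C₂ (low-end b)) (sym eq) part₂
    ; above-part = subst (λ b → Part a P C₁ (high-end b)) (sym eq) part₁
    }

-- Bisection of products of two Cantor sets

X-lower : ∀ d {w τ} → Digits w → 1ℚ ≤ τ → ⌜ d ⌝ ≤ X (d ∷ w) τ
X-lower d w⁺ 1≤τ = ≤+nonNeg (0≤inv (1≤⇒0≤ (1≤X w⁺ 1≤τ)))

X-upper : ∀ d {w τ} → Digits w → 1ℚ ≤ τ → X (d ∷ w) τ ≤ ⌜ d ⌝ + 1ℚ
X-upper d w⁺ 1≤τ = +-monoʳ-≤ ⌜ d ⌝ (inv≤1 (1≤X w⁺ 1≤τ))

X-close : ∀ k {w x y} → Digits w → k ℕ.+ k ℕ.< length w → 1ℚ ≤ x → 1ℚ ≤ y →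
  ∣ X w x - X w y ∣ ≤ 1/suc k
X-close zero {d ∷ w} (_ ∷ w⁺) _ 1≤x 1≤y = ∣p-q∣≤
  (≤-trans (X-upper d w⁺ 1≤x) (+-monoˡ-≤ 1ℚ (X-lower d w⁺ 1≤y)))
  (≤-trans (X-upper d w⁺ 1≤y) (+-monoˡ-≤ 1ℚ (X-lower d w⁺ 1≤x)))
X-close (suc k) {d ∷ []} (_ ∷ []) (s≤s ()) 1≤x 1≤y
X-close (suc k) {d ∷ e ∷ w} (_ ∷ e⁺ ∷ w⁺) (s≤s long) 1≤x 1≤y = ≤-trans
  (two-steps ⌜ d ⌝ (⌜⌝-mono e⁺) (1≤X w⁺ 1≤x) (1≤X w⁺ 1≤y))
  (≤-trans (*-monoˡ-≤-nonNeg ½ (X-close k w⁺ long′ 1≤x 1≤y))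
    (½*1/suc≤ k))
  where
  long′ : k ℕ.+ k ℕ.< length w
  long′ = ℕ.s≤s⁻¹ (subst (ℕ._≤ suc (length w)) (ℕₚ.+-suc (suc k) k) long)

inv-injective : ∀ {u v} → 1ℚ ≤ u → 1ℚ ≤ v → inv u ≡ inv v → u ≡ v
inv-injective {u} {v} 1≤u 1≤v eq = begin
  u                 ≡⟨ *-identityʳ u ⟨
  u * 1ℚ            ≡⟨ cong (u *_) (*-inv 1≤v) ⟨
  u * (v * inv v)   ≡⟨ cong (λ x → u * (v * x)) eq ⟨
  u * (v * inv u)   ≡⟨ solve 3 (λ u v x → u :* (v :* x) := (u :* x) :* v) refl u v (inv u) ⟩
  (u * inv u) * v   ≡⟨ cong (_* v) (*-inv 1≤u) ⟩
  1ℚ * v            ≡⟨ *-identityˡ v ⟩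
  v                 ∎
  where
  open ≡-Reasoning
  open +-*-Solver

X-injective : ∀ w {x y} → Digits w → 1ℚ ≤ x → 1ℚ ≤ y → X w x ≡ X w y → x ≡ y
X-injective []      _          _   _   eq = eq
X-injective (d ∷ w) (_ ∷ w⁺) 1≤x 1≤y eq = X-injective w w⁺ 1≤x 1≤y
  (inv-injective (1≤X w⁺ 1≤x) (1≤X w⁺ 1≤y) (+-cancelˡ ⌜ d ⌝ eq))
  where
  +-cancelˡ : ∀ c {x y} → c + x ≡ c + y → x ≡ y
  +-cancelˡ c {x} {y} h = trans (sym (lemma c x)) (trans (cong (λ z → z - c) h) (lemma c y))
    where
    open +-*-Solver
    lemma : ∀ c x → c + x - c ≡ x
    lemma = solve 2 (λ c x → c :+ x :- c := x) refl

X-image-< : ∀ w {x y} → Digits w → 1ℚ ≤ x → x < y → proj₁ (X-image w (x , y)) < proj₂ (X-image w (x , y))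
X-image-< w {x} {y} w⁺ 1≤x x<y = go (increasing w) (X-directed w w⁺ 1≤x (<⇒≤ x<y)) λ eq →
  <-irrefl (X-injective w w⁺ 1≤x (≤-trans 1≤x (<⇒≤ x<y)) eq) x<y
  where
  go : ∀ b {u v} → Directed b u v → ¬ (u ≡ v) → proj₁ (orient b (u , v)) < proj₂ (orient b (u , v))
  go true  u≤v u≢v = ≰⇒> λ v≤u → u≢v (≤-antisym u≤v v≤u)
  go false v≤u u≢v = ≰⇒> λ u≤v → u≢v (≤-antisym u≤v v≤u)

both-orientations : ∀ (Φ : ℚ → ℚ → Set) b {u v} → Φ u v → Φ v u →
  Φ (proj₁ (orient b (u , v))) (proj₂ (orient b (u , v)))
both-orientations Φ true  h _ = h
both-orientations Φ false _ h = h

above-1-image : ∀ {w} I → Digits w → Above-1 I → Above-1 (X-image w I)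
above-1-image {w} I w⁺ (1≤x , 1≤y) = both-orientations (λ u v → 1ℚ ≤ u × 1ℚ ≤ v) (increasing w)
  (1≤X w⁺ 1≤x , 1≤X w⁺ 1≤y) (1≤X w⁺ 1≤y , 1≤X w⁺ 1≤x)

module _ {a} (1≤a : 1 ℕ.≤ a) (P : Node) where

  above-1-hull : Above-1 (node-hull a P)
  above-1-hull = above-1-image (hull (state P) (index P)) (centred-digits 1≤a P)
    (proj₁ (splits (state P) (index< P)))

  above-1-gap : Above-1 (node-gap a P)
  above-1-gap = above-1-image (gap (state P) (index P)) (centred-digits 1≤a P)
    (proj₁ (proj₂ (splits (state P) (index< P))))

  gap-< : proj₁ (node-gap a P) < proj₂ (node-gap a P)
  gap-< = X-image-< (a ∷ word P) (centred-digits 1≤a P) (proj₁ (proj₁ (proj₂ (splits (state P) (index< P)))))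
    (proj₁ (proj₂ (proj₂ (splits (state P) (index< P)))))

⊑-trans : ∀ I J K → Above-1 I → Above-1 J → Above-1 K → I ⊑ J → J ⊑ K → I ⊑ K
⊑-trans (u , v) (c , d) (e , f) (1≤u , _) (1≤c , _) (1≤e , _) vc≤ud de≤cf = *-cancelʳ c (1≤⇒0< 1≤c) (begin
  v * e * c   ≡⟨ solve 3 (λ v e c → v :* e :* c := v :* c :* e) refl v e c ⟩
  v * c * e   ≤⟨ *-monoʳ e (1≤⇒0≤ 1≤e) vc≤ud ⟩
  u * d * e   ≡⟨ *-assoc u d e ⟩
  u * (d * e) ≤⟨ *-monoˡ u (1≤⇒0≤ 1≤u) de≤cf ⟩
  u * (c * f) ≡⟨ solve 3 (λ u c f → u :* (c :* f) := u :* f :* c) refl u c f ⟩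
  u * f * c   ∎)
  where
  open ≤-Reasoning
  open +-*-Solver

⊑-total : ∀ I J → I ⊑ J ⊎ J ⊑ I
⊑-total (u , v) (c , d) with ≤-total (v * c) (u * d)
... | inj₁ h = inj₁ h
... | inj₂ h = inj₂ (subst₂ _≤_ (*-comm u d) (*-comm v c) h)

size⇒length : ∀ n P → 3 ℕ.* suc n ℕ.≤ size P → n ℕ.≤ length (word P)
size⇒length n P h = ℕₚ.≮⇒≥ λ len<n → ℕₚ.<⇒≱ (begin-strict
  3 ℕ.* length (word P) ℕ.+ index P <⟨ ℕₚ.+-monoʳ-< _ (ℕₚ.<-≤-trans (index< P) (top-1≤3 (state P))) ⟩
  3 ℕ.* length (word P) ℕ.+ 3       ≡⟨ ℕₚ.+-comm (3 ℕ.* length (word P)) 3 ⟩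
  3 ℕ.+ 3 ℕ.* length (word P)       ≡⟨ ℕₚ.*-suc 3 (length (word P)) ⟨
  3 ℕ.* suc (length (word P))       ≤⟨ ℕₚ.*-monoʳ-≤ 3 (ℕₚ.m≤n⇒m≤1+n len<n) ⟩
  3 ℕ.* suc n                       ∎) h
  where
  open ℕₚ.≤-Reasoning

p≤∣p∣ : ∀ p → p ≤ ∣ p ∣
p≤∣p∣ p with ≤-total 0ℚ p
... | inj₁ 0≤p = ≤-reflexive (sym (0≤p⇒∣p∣≡p 0≤p))
... | inj₂ p≤0 = ≤-trans p≤0 (0≤∣p∣ p)

y+[x-y]≡x : ∀ x y → y + (x - y) ≡ x
y+[x-y]≡x = solve 2 (λ x y → y :+ (x :- y) := x) refl
  where open +-*-Solver

∣-∣≤⇒≤+ : ∀ {x y r} → ∣ x - y ∣ ≤ r → x ≤ y + r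
∣-∣≤⇒≤+ {x} {y} {r} h = subst (_≤ y + r) (y+[x-y]≡x x y)
  (+-monoʳ-≤ y (≤-trans (p≤∣p∣ (x - y)) h))

image-close : ∀ k {w} I → Digits w → k ℕ.+ k ℕ.< length w → Above-1 I →
  proj₂ (X-image w I) ≤ proj₁ (X-image w I) + 1/suc k
image-close k {w} (x , y) w⁺ long (1≤x , 1≤y) = both-orientations (λ u v → v ≤ u + 1/suc k) (increasing w)
  (∣-∣≤⇒≤+ (X-close k w⁺ long 1≤y 1≤x)) (∣-∣≤⇒≤+ (X-close k w⁺ long 1≤x 1≤y))

opaque
  -- Behind a word longer than 2k a gap has width at most 1/(k + 1), and its endpoints are at least
  -- 1, so its ratio is at most 1 + 1/(k + 1). This is below the fixed ratio v/u > 1 of the gap of P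
  -- once 1/(k + 1) < (v - u)/u.
  gaps-vanish : ∀ {a b} → 1 ℕ.≤ a → 1 ℕ.≤ b → ∀ P → ∃ λ n → ∀ Q → n ℕ.≤ size Q → node-gap b Q ⊑ node-gap a P
  gaps-vanish {a} {b} 1≤a 1≤b P = 3 ℕ.* suc (k ℕ.+ k) , λ Q n≤ →
    let (c , d) = node-gap b Q
        1≤c = proj₁ (above-1-gap 1≤b Q)
        d≤c+η = image-close k (gap (state Q) (index Q)) (centred-digits 1≤b Q) (s≤s (size⇒length (k ℕ.+ k) Q n≤))
          (proj₁ (proj₂ (splits (state Q) (index< Q))))
    in begin
      d * u               ≤⟨ *-monoʳ u (1≤⇒0≤ 1≤u) d≤c+η ⟩
      (c + 1/suc k) * u   ≡⟨ *-distribʳ-+ u c (1/suc k) ⟩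
      c * u + 1/suc k * u ≤⟨ +-monoʳ-≤ (c * u) (*-monoʳ u (1≤⇒0≤ 1≤u) (<⇒≤ η<)) ⟩
      c * u + (v - u) * inv u * u ≡⟨ cong (λ x → c * u + x) (*-inv-cancel (v - u) 1≤u) ⟩
      c * u + (v - u)     ≤⟨ +-monoʳ-≤ (c * u) (subst (_≤ c * (v - u)) (*-identityˡ (v - u))
                              (*-monoʳ (v - u) (<⇒≤ 0<v-u) 1≤c)) ⟩
      c * u + c * (v - u) ≡⟨ solve 3 (λ c u v → c :* u :+ c :* (v :- u) := c :* v) refl c u v ⟩
      c * v               ∎
    where
    open ≤-Reasoning
    open +-*-Solver
    u v : ℚ
    u = proj₁ (node-gap a P)
    v = proj₂ (node-gap a P)
    1≤u : 1ℚ ≤ u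
    1≤u = proj₁ (above-1-gap 1≤a P)
    0<v-u : 0ℚ < v - u
    0<v-u = subst (_< v - u) (+-inverseʳ u) (+-monoˡ-< (- u) (gap-< 1≤a P))
    arch : ∃ λ k → 1/suc k < (v - u) * inv u
    arch = archimedean ((v - u) * inv u) (*-pos 0<v-u (inv-positive 1≤u))
    k : ℕ
    k = proj₁ arch
    η< : 1/suc k < (v - u) * inv u
    η< = proj₂ arch

-- If a gap (u, v) is multiplied by a hull (c, d), the products from below the gap reach up to u · d
-- and those from above start at v · c. The last two fields say that these ranges overlap, for
-- either factor.
record Bracket (a b : ℕ) (t : ℚ) (P Q : Node) : Set where
  constructor bracket
  field
    lower  : proj₁ (node-hull a P) * proj₁ (node-hull b Q) ≤ t
    upper  : t ≤ proj₂ (node-hull a P) * proj₂ (node-hull b Q)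
    gap₁⊑  : node-gap a P ⊑ node-hull b Q
    gap₂⊑  : node-gap b Q ⊑ node-hull a P

swap : ∀ {a b t P Q} → Bracket a b t P Q → Bracket b a t Q P
swap {a} {b} {t} {P} {Q} (bracket l u g₁ g₂) = bracket
  (subst (_≤ t) (*-comm (proj₁ (node-hull a P)) (proj₁ (node-hull b Q))) l)
  (subst (t ≤_) (*-comm (proj₂ (node-hull a P)) (proj₂ (node-hull b Q))) u) g₂ g₁

-- The node with the larger gap is split: the other one bridges that gap, and both parts are
-- large enough to bridge the other gap.
split-larger : ∀ {a b t P Q} → 1 ℕ.≤ a → 1 ℕ.≤ b → Bracket a b t P Q → node-gap b Q ⊑ node-gap a P →
  ∃ λ P′ → size P ℕ.< size P′ × Bracket a b t P′ Q
split-larger {a} {b} {t} {P} {Q} 1≤a 1≤b (bracket l u g₁ g₂) gQ⊑gP =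
  go (≤-total t (proj₁ (node-gap a P) * proj₂ (node-hull b Q)))
  where
  hullQ = node-hull b Q
  S = split 1≤a P
  widen : ∀ {P′ x y} → Part a P P′ (x , y) → x * proj₁ hullQ ≤ t → t ≤ y * proj₂ hullQ →
    ∃ λ P′ → size P ℕ.< size P′ × Bracket a b t P′ Q
  widen {P′} part′ x≤t t≤y = P′ , larger part′ , bracket
    (≤-trans (*-monoʳ (proj₁ hullQ) (1≤⇒0≤ (proj₁ (above-1-hull 1≤b Q))) (proj₁ (covers part′))) x≤t)
    (≤-trans t≤y (*-monoʳ (proj₂ hullQ) (1≤⇒0≤ (proj₂ (above-1-hull 1≤b Q))) (proj₂ (covers part′))))
    (⊑-trans (node-gap a P′) (node-gap a P) hullQ
      (above-1-gap 1≤a P′) (above-1-gap 1≤a P) (above-1-hull 1≤b Q) (gap⊑gap part′) g₁)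
    (⊑-trans (node-gap b Q) (node-gap a P) (node-hull a P′)
      (above-1-gap 1≤b Q) (above-1-gap 1≤a P) (above-1-hull 1≤a P′) gQ⊑gP (gap⊑hull part′))
  go : t ≤ proj₁ (node-gap a P) * proj₂ hullQ ⊎ proj₁ (node-gap a P) * proj₂ hullQ ≤ t →
    ∃ λ P′ → size P ℕ.< size P′ × Bracket a b t P′ Q
  go (inj₁ t≤) = widen (below-part S) l t≤
  go (inj₂ t≥) = widen (above-part S) (≤-trans g₁ t≥) u

Refinement : (a b : ℕ) (t : ℚ) (m n : ℕ) → Set
Refinement a b t m n = ∃₂ λ P Q → m ℕ.≤ size P × n ℕ.≤ size Q × Bracket a b t P Q

-- P can be split only when its gap is the larger one. Until then Q is split; its size grows each
-- time, and from size N on its gap is dominated by that of P, which bounds the number of rounds.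
advance : ∀ {a b t P Q} → 1 ℕ.≤ a → 1 ℕ.≤ b → Bracket a b t P Q → Refinement a b t (suc (size P)) (size Q)
advance {a} {b} {t} {P} {Q} 1≤a 1≤b B = go N Q B (ℕₚ.m≤n+m N (size Q)) ℕₚ.≤-refl
  where
  N = proj₁ (gaps-vanish 1≤a 1≤b P)
  split-left : ∀ {Q′} → Bracket a b t P Q′ → size Q ℕ.≤ size Q′ → node-gap b Q′ ⊑ node-gap a P →
    Refinement a b t (suc (size P)) (size Q)
  split-left {Q′} B′ Q≤Q′ h = let P′ , P<P′ , B″ = split-larger 1≤a 1≤b B′ h in P′ , Q′ , P<P′ , Q≤Q′ , B″
  go : ∀ fuel Q′ → Bracket a b t P Q′ → N ℕ.≤ size Q′ ℕ.+ fuel → size Q ℕ.≤ size Q′ →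
    Refinement a b t (suc (size P)) (size Q)
  choose : ∀ fuel Q′ → Bracket a b t P Q′ → N ℕ.≤ size Q′ ℕ.+ suc fuel → size Q ℕ.≤ size Q′ →
    node-gap b Q′ ⊑ node-gap a P ⊎ node-gap a P ⊑ node-gap b Q′ →
    Refinement a b t (suc (size P)) (size Q)
  go zero Q′ B′ N≤ Q≤Q′ = split-left B′ Q≤Q′
    (proj₂ (gaps-vanish 1≤a 1≤b P) Q′ (subst (N ℕ.≤_) (ℕₚ.+-identityʳ (size Q′)) N≤))
  go (suc fuel) Q′ B′ N≤ Q≤Q′ =
    choose fuel Q′ B′ N≤ Q≤Q′ (⊑-total (node-gap b Q′) (node-gap a P))
  choose fuel Q′ B′ N≤ Q≤Q′ (inj₁ h) = split-left B′ Q≤Q′ h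
  choose fuel Q′ B′ N≤ Q≤Q′ (inj₂ h) = let Q″ , Q′<Q″ , B″ = split-larger 1≤b 1≤a (swap B′) h
    in go fuel Q″ (swap B″)
      (ℕₚ.≤-trans N≤ (subst (ℕ._≤ size Q″ ℕ.+ fuel) (sym (ℕₚ.+-suc (size Q′) fuel)) (ℕₚ.+-monoˡ-≤ fuel Q′<Q″)))
      (ℕₚ.≤-trans Q≤Q′ (ℕₚ.<⇒≤ Q′<Q″))

swap-refinement : ∀ {a b t m n} → Refinement a b t m n → Refinement b a t n m
swap-refinement (P , Q , m≤ , n≤ , B) = Q , P , n≤ , m≤ , swap B

refineˡ : ∀ {a b t} → 1 ℕ.≤ a → 1 ℕ.≤ b → ∀ m {n} → Refinement a b t 0 n → Refinement a b t m n
refineˡ 1≤a 1≤b zero    R = R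
refineˡ {a} {b} {t} 1≤a 1≤b (suc m) {n} R = go (refineˡ 1≤a 1≤b m R)
  where
  go : Refinement a b t m n → Refinement a b t (suc m) n
  go (P , Q , m≤ , n≤ , B) = let P′ , Q′ , P<P′ , Q≤Q′ , B′ = advance 1≤a 1≤b B
    in P′ , Q′ , ℕₚ.≤-trans (s≤s m≤) P<P′ , ℕₚ.≤-trans n≤ Q≤Q′ , B′

refine : ∀ {a b t P Q} → 1 ℕ.≤ a → 1 ℕ.≤ b → Bracket a b t P Q → ∀ n → Refinement a b t n n
refine 1≤a 1≤b B n = refineˡ 1≤a 1≤b n (swap-refinement (refineˡ 1≤b 1≤a n (_ , _ , z≤n , z≤n , swap B)))

-- Approximating a given product by finite words

root : Node
root = record { word = [] ; accepted = tt ; index = 0 ; index< = s≤s z≤n }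

module _ (A B : ℚ) (0≤A : 0ℚ ≤ A) where

  open +-*-Solver

  -- The constants are the reciprocals of the ends of `gap after-4 0` = (53/29, 53/24) and of
  -- `hull after-4 0` = (29/24, 91/24). The larger B is, the smaller the ratio of its hull, hence
  -- the bound on B.
  gap⊑hull-root : B ≤ A + 1ℚ →
    (A + + 29 / 53) * (B + + 24 / 91) ≤ (A + + 24 / 53) * (B + + 24 / 29)
  gap⊑hull-root B≤ = ≤-by (A * c₁ + (A + 1ℚ - B) * (+ 5 / 53) + c₀)
    (+-nonNeg (+-nonNeg
      (*-nonNeg 0≤A (from-yes (0ℚ ≤? c₁)))
      (*-nonNeg (0≤- B≤) (from-yes (0ℚ ≤? + 5 / 53))))
      (from-yes (0ℚ ≤? c₀)))
    (solve 2 (λ A B →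
      (A :+ con (+ 24 / 53)) :* (B :+ con (+ 24 / 29)) :=
      (A :+ con (+ 29 / 53)) :* (B :+ con (+ 24 / 91)) :+
      (A :* con c₁ :+ (A :+ con 1ℚ :- B) :* con (+ 5 / 53) :+ con c₀)) refl A B)
    where
    c₀ c₁ : ℚ
    c₁ = + 24 / 29 - + 24 / 91 - + 5 / 53
    c₀ = + 24 / 53 * (+ 24 / 29) - + 29 / 53 * (+ 24 / 91) - + 5 / 53

  -- The products available at the centre (A, B) and at its successor (B, A + 1) leave no room
  -- between them, so the centres together reach every large t.
  roots-overlap : ⌜ 4 ⌝ ≤ A → B ≤ A + 1ℚ →
    (B + + 24 / 91) * (A + 1ℚ + + 24 / 91) ≤ (A + + 24 / 29) * (B + + 24 / 29)
  roots-overlap 4≤A B≤ = ≤-by ((A - ⌜ 4 ⌝) * c₁ + (A + 1ℚ - B) * c₂ + c₀)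
    (+-nonNeg (+-nonNeg
      (*-nonNeg (0≤- 4≤A) (from-yes (0ℚ ≤? c₁)))
      (*-nonNeg (0≤- B≤) (from-yes (0ℚ ≤? c₂))))
      (from-yes (0ℚ ≤? c₀)))
    (solve 2 (λ A B →
      (A :+ con (+ 24 / 29)) :* (B :+ con (+ 24 / 29)) :=
      (B :+ con (+ 24 / 91)) :* (A :+ con 1ℚ :+ con (+ 24 / 91)) :+
      ((A :- con ⌜ 4 ⌝) :* con c₁ :+ (A :+ con 1ℚ :- B) :* con c₂ :+ con c₀)) refl A B)
    where
    h l c₀ c₁ c₂ : ℚ
    h = + 24 / 29
    l = + 24 / 91
    c₂ = 1ℚ + l - h
    c₁ = (h - l) - c₂
    c₀ = ⌜ 4 ⌝ * c₁ - c₂ + (h * h - l - l * l)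

-- Runs through (4, 4), (4, 5), (5, 5), (5, 6), and so on.
centre : ℕ → ℕ × ℕ
centre zero    = 4 , 4
centre (suc k) = let (a , b) = centre k in b , suc a

⌜suc⌝ : ∀ n → ⌜ suc n ⌝ ≡ ⌜ n ⌝ + 1ℚ
⌜suc⌝ n = /-suc n 0

record Centre (a b : ℕ) : Set where
  field
    4≤a : 4 ℕ.≤ a
    4≤b : 4 ℕ.≤ b
    a≤b : a ℕ.≤ b
    b≤1+a : b ℕ.≤ suc a

centre-valid : ∀ k → Centre (proj₁ (centre k)) (proj₂ (centre k))
centre-valid zero    = record { 4≤a = ℕₚ.≤-refl ; 4≤b = ℕₚ.≤-refl ; a≤b = ℕₚ.≤-refl ; b≤1+a = ℕₚ.n≤1+n 4 }
centre-valid (suc k) = let open Centre (centre-valid k) in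
  record { 4≤a = 4≤b ; 4≤b = ℕₚ.m≤n⇒m≤1+n 4≤a ; a≤b = b≤1+a ; b≤1+a = s≤s a≤b }

lower-end upper-end : ℕ × ℕ → ℚ
lower-end (a , b) = (⌜ a ⌝ + + 24 / 91) * (⌜ b ⌝ + + 24 / 91)
upper-end (a , b) = (⌜ a ⌝ + + 24 / 29) * (⌜ b ⌝ + + 24 / 29)

0≤⌜⌝+ : ∀ n {x} → 0ℚ ≤ x → 0ℚ ≤ ⌜ n ⌝ + x
0≤⌜⌝+ n = +-nonNeg (0≤⌜⌝ n)

module _ {a b} (C : Centre a b) where

  open Centre C

  A≤B+1 : ⌜ a ⌝ ≤ ⌜ b ⌝ + 1ℚ
  A≤B+1 = ≤-trans (⌜⌝-mono a≤b) (≤+nonNeg {⌜ b ⌝} {1ℚ} 0≤1)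

  B≤A+1 : ⌜ b ⌝ ≤ ⌜ a ⌝ + 1ℚ
  B≤A+1 = subst (⌜ b ⌝ ≤_) (⌜suc⌝ a) (⌜⌝-mono b≤1+a)

  root-bracket : ∀ {t} → lower-end (a , b) ≤ t → t ≤ upper-end (a , b) → Bracket a b t root root
  root-bracket l u = bracket l u
    (gap⊑hull-root ⌜ a ⌝ ⌜ b ⌝ (0≤⌜⌝ a) B≤A+1) (gap⊑hull-root ⌜ b ⌝ ⌜ a ⌝ (0≤⌜⌝ b) A≤B+1)

  next-lower-end : lower-end (b , suc a) ≤ upper-end (a , b)
  next-lower-end = subst (λ x → (⌜ b ⌝ + + 24 / 91) * (x + + 24 / 91) ≤ upper-end (a , b)) (sym (⌜suc⌝ a))
    (roots-overlap ⌜ a ⌝ ⌜ b ⌝ (0≤⌜⌝ a) (⌜⌝-mono 4≤a) B≤A+1)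

integer-above : ∀ r → ∃ λ n → r ≤ ⌜ n ⌝
integer-above r@(mkℚ (+ n) d _) = n , subst (_≤ ⌜ n ⌝) (↥p/↧p≡p r)
  (/-mono-≤ (+ n) d (+ n) 0 (subst₂ ℤ._≤_ (ℤₚ.pos-* n 1) (ℤₚ.pos-* n (suc d)) (ℤ.+≤+ (ℕₚ.*-monoʳ-≤ n (s≤s z≤n)))))
integer-above r@(mkℚ ℤ.-[1+ _ ] d _) = 0 , <⇒≤ (negative⁻¹ r)

k≤centre : ∀ k → k ℕ.≤ proj₁ (centre k) ℕ.+ proj₂ (centre k)
k≤centre zero    = z≤n
k≤centre (suc k) = let a , b = centre k in
  subst (suc k ℕ.≤_) (trans (cong suc (ℕₚ.+-comm a b)) (sym (ℕₚ.+-suc b a))) (s≤s (k≤centre k))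

⌜k⌝≤lower-end : ∀ k → ⌜ k ⌝ ≤ lower-end (centre k)
⌜k⌝≤lower-end k = ≤-trans (⌜⌝-mono (ℕₚ.≤-trans (k≤centre k) (ℕₚ.≤-trans (ℕₚ.+-mono-≤ (ℕₚ.m≤m+n a a) ℕₚ.≤-refl) h)))
  (subst (_≤ lower-end (centre k)) (trans (sym (/1-homo-* (+ a) (+ b))) (cong (_/ 1) (sym (ℤₚ.pos-* a b))))
    (*-mono {⌜ a ⌝} {⌜ a ⌝ + + 24 / 91} {⌜ b ⌝} {⌜ b ⌝ + + 24 / 91}
      (0≤⌜⌝ b) (0≤⌜⌝+ a l≥0) (≤+nonNeg {⌜ a ⌝} l≥0) (≤+nonNeg {⌜ b ⌝} l≥0)))
  where
  l≥0 : 0ℚ ≤ + 24 / 91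
  l≥0 = from-yes (0ℚ ≤? + 24 / 91)
  a b : ℕ
  a = proj₁ (centre k)
  b = proj₂ (centre k)
  open Centre (centre-valid k)
  h : a ℕ.+ a ℕ.+ b ℕ.≤ a ℕ.* b
  h = begin
    a ℕ.+ a ℕ.+ b   ≤⟨ ℕₚ.+-mono-≤ (ℕₚ.+-mono-≤ a≤b a≤b) (ℕₚ.m≤m+n b (b ℕ.+ 0)) ⟩
    b ℕ.+ b ℕ.+ (b ℕ.+ (b ℕ.+ 0)) ≡⟨ ℕₚ.+-assoc b b (b ℕ.+ (b ℕ.+ 0)) ⟩
    4 ℕ.* b         ≤⟨ ℕₚ.*-monoˡ-≤ b 4≤a ⟩
    a ℕ.* b         ∎
    where open ℕₚ.≤-Reasoning

choose-centre : ∀ {r} → lower-end (4 , 4) ≤ r → ∃ λ k → lower-end (centre k) ≤ r × r ≤ upper-end (centre k)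
choose-centre {r} l = search 0 n l
  (subst (λ m → r ≤ lower-end (centre m)) (sym (ℕₚ.+-identityʳ n)) (≤-trans r≤n (⌜k⌝≤lower-end n)))
  where
  n = proj₁ (integer-above r)
  r≤n = proj₂ (integer-above r)
  search : ∀ k m → lower-end (centre k) ≤ r → r ≤ lower-end (centre (m ℕ.+ k)) →
    ∃ λ k → lower-end (centre k) ≤ r × r ≤ upper-end (centre k)
  compare : ∀ k m → lower-end (centre k) ≤ r → r ≤ lower-end (centre (suc m ℕ.+ k)) →
    lower-end (centre (suc k)) ≤ r ⊎ r ≤ lower-end (centre (suc k)) →
    ∃ λ k → lower-end (centre k) ≤ r × r ≤ upper-end (centre k)
  search k zero    l h = k , l , ≤-trans h
    (*-mono (0≤⌜⌝+ b l≥0) (0≤⌜⌝+ a h≥0) (+-monoʳ-≤ ⌜ a ⌝ l≤h) (+-monoʳ-≤ ⌜ b ⌝ l≤h))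
    where
    a = proj₁ (centre k)
    b = proj₂ (centre k)
    l≥0 = from-yes (0ℚ ≤? + 24 / 91)
    h≥0 = from-yes (0ℚ ≤? + 24 / 29)
    l≤h = from-yes (+ 24 / 91 ≤? + 24 / 29)
  search k (suc m) l h = compare k m l h (≤-total (lower-end (centre (suc k))) r)
  compare k m l h (inj₁ l′) = search (suc k) m l′ (subst (λ n → r ≤ lower-end (centre n)) (sym (ℕₚ.+-suc m k)) h)
  compare k m l h (inj₂ u′) = k , l , ≤-trans u′ (next-lower-end (centre-valid k))

-- `small` separates the delicate centre (4, 4) from values for which crude estimates suffice;
-- `adjacent` serves the cuts next to the centre. The product bounds hold for all continuations,
-- since the refined words already determine the product up to ε.
record Block (r ε : ℚ) : Set where
  field
    a b      : ℕ
    v w      : List ℕ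
    4≤a      : 4 ℕ.≤ a
    4≤b      : 4 ℕ.≤ b
    v-accept : Accepts after-4 v
    w-accept : Accepts after-4 w
    small    : (a ≡ 4 × b ≡ 4) ⊎ ⌜ 20 ⌝ ≤ r
    adjacent : (⌜ a ⌝ + + 1 / 4) * (⌜ b ⌝ + + 1 / 4) ≤ r
    product≤ : ∀ {σ τ} → 1ℚ ≤ σ → 1ℚ ≤ τ → X (a ∷ v) σ * X (b ∷ w) τ ≤ r + ε
    ≤product : ∀ {σ τ} → 1ℚ ≤ σ → 1ℚ ≤ τ → r ≤ X (a ∷ v) σ * X (b ∷ w) τ + ε

image-near : ∀ k {w x} I → Digits w → k ℕ.+ k ℕ.< length w → Above-1 I → 1ℚ ≤ x →
  X w x ≤ proj₁ (X-image w I) + 1/suc k × proj₂ (X-image w I) ≤ X w x + 1/suc k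
image-near k {w} {x} (s , s′) w⁺ long (1≤s , 1≤s′) 1≤x =
  both-orientations (λ u v → X w x ≤ u + 1/suc k × v ≤ X w x + 1/suc k) (increasing w)
    (near 1≤s , near′ 1≤s′) (near 1≤s′ , near′ 1≤s)
  where
  near : ∀ {s} → 1ℚ ≤ s → X w x ≤ X w s + 1/suc k
  near 1≤s = ∣-∣≤⇒≤+ (X-close k w⁺ long 1≤x 1≤s)
  near′ : ∀ {s} → 1ℚ ≤ s → X w s ≤ X w x + 1/suc k
  near′ 1≤s = ∣-∣≤⇒≤+ (X-close k w⁺ long 1≤s 1≤x)

image-upper : ∀ d {w} I → Digits w → Above-1 I → proj₁ (X-image (d ∷ w) I) ≤ ⌜ d ⌝ + 1ℚ
image-upper d {w} (s , s′) w⁺ (1≤s , 1≤s′) =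
  both-orientations (λ u _ → u ≤ ⌜ d ⌝ + 1ℚ) (increasing (d ∷ w)) (X-upper d w⁺ 1≤s) (X-upper d w⁺ 1≤s′)

product-close : ∀ {x y x′ y′ A B η} → 0ℚ ≤ x′ → 0ℚ ≤ y → 0ℚ ≤ η → η ≤ 1ℚ →
  x ≤ x′ + η → y ≤ y′ + η → x′ ≤ A → y′ ≤ B →
  x * y ≤ x′ * y′ + η * (A + B + 1ℚ)
product-close {x} {y} {x′} {y′} {A} {B} {η} 0≤x′ 0≤y 0≤η η≤1 x≤ y≤ x′≤A y′≤B = begin
  x * y                           ≤⟨ *-mono 0≤y (+-nonNeg 0≤x′ 0≤η) x≤ y≤ ⟩
  (x′ + η) * (y′ + η)             ≡⟨ expand x′ y′ η ⟩
  x′ * y′ + η * (x′ + y′ + η)     ≤⟨ +-monoʳ-≤ (x′ * y′) (*-monoˡ η 0≤η (+-mono-≤ (+-mono-≤ x′≤A y′≤B) η≤1)) ⟩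
  x′ * y′ + η * (A + B + 1ℚ)      ∎
  where
  open ≤-Reasoning
  open +-*-Solver
  expand : ∀ x y η → (x + η) * (y + η) ≡ x * y + η * (x + y + η)
  expand = solve 3 (λ x y η → (x :+ η) :* (y :+ η) := x :* y :+ η :* (x :+ y :+ η)) refl

module _ {r ε : ℚ} (0<ε : 0ℚ < ε) {a b : ℕ} (C : Centre a b) where

  open Centre C

  private
    A B M : ℚ
    A = ⌜ a ⌝ + 1ℚ
    B = ⌜ b ⌝ + 1ℚ
    M = A + B + 1ℚ
    1≤M : 1ℚ ≤ M
    1≤M = subst (_≤ M) (+-identityˡ 1ℚ) (+-monoˡ-≤ 1ℚ
      (+-nonNeg (0≤⌜⌝+ a 0≤1) (0≤⌜⌝+ b 0≤1)))
    1≤a : 1 ℕ.≤ a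
    1≤a = ℕₚ.≤-trans (s≤s z≤n) 4≤a
    1≤b : 1 ℕ.≤ b
    1≤b = ℕₚ.≤-trans (s≤s z≤n) 4≤b

  precision : ∃ λ k → 1/suc k * M ≤ ε
  precision = let k , k< = archimedean (ε * inv M) (*-pos 0<ε (inv-positive 1≤M)) in
    k , subst (1/suc k * M ≤_) (*-inv-cancel ε 1≤M)
      (*-monoʳ M (1≤⇒0≤ 1≤M) (<⇒≤ k<))

  block-from : (a ≡ 4 × b ≡ 4) ⊎ ⌜ 20 ⌝ ≤ r → lower-end (a , b) ≤ r → r ≤ upper-end (a , b) → Block r ε
  block-from small l u = go precision
    where
    go : (∃ λ k → 1/suc k * M ≤ ε) → Block r ε
    go (k , ηM≤ε) = build (refine 1≤a 1≤b (root-bracket C l u) (3 ℕ.* suc (k ℕ.+ k)))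
      where
      η : ℚ
      η = 1/suc k
      0≤η : 0ℚ ≤ η
      0≤η = /-mono-≤ (+ 0) 0 (+ 1) k (ℤ.+≤+ z≤n)
      η≤1 : η ≤ 1ℚ
      η≤1 = 1/suc-antimono {0} {k} z≤n
      build : Refinement a b r (3 ℕ.* suc (k ℕ.+ k)) (3 ℕ.* suc (k ℕ.+ k)) → Block r ε
      build (P , Q , m≤ , n≤ , B′) = record
        { a = a ; b = b ; v = word P ; w = word Q ; 4≤a = 4≤a ; 4≤b = 4≤b
        ; v-accept = accepted P ; w-accept = accepted Q ; small = small
        ; adjacent = ≤-trans
            (*-mono (0≤⌜⌝+ b (from-yes (0ℚ ≤? + 1 / 4))) (0≤⌜⌝+ a (from-yes (0ℚ ≤? + 24 / 91)))
              (+-monoʳ-≤ ⌜ a ⌝ (from-yes (+ 1 / 4 ≤? + 24 / 91)))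
              (+-monoʳ-≤ ⌜ b ⌝ (from-yes (+ 1 / 4 ≤? + 24 / 91)))) l
        ; product≤ = λ 1≤σ 1≤τ → ≤-trans
            (product-close (1≤⇒0≤ (proj₁ (above-1-hull 1≤a P))) (1≤⇒0≤ (1≤X Q⁺ 1≤τ)) 0≤η η≤1
              (proj₁ (nearP 1≤σ)) (proj₁ (nearQ 1≤τ)) upperP upperQ)
            (+-mono-≤ (Bracket.lower B′) ηM≤ε)
        ; ≤product = λ {σ} {τ} 1≤σ 1≤τ → ≤-trans (Bracket.upper B′) (≤-trans
            (product-close (1≤⇒0≤ (1≤X P⁺ 1≤σ)) (1≤⇒0≤ (proj₂ (above-1-hull 1≤b Q))) 0≤η η≤1
              (proj₂ (nearP 1≤σ)) (proj₂ (nearQ 1≤τ))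
              (X-upper a (accepts⇒digits after-4 (accepted P)) 1≤σ)
              (X-upper b (accepts⇒digits after-4 (accepted Q)) 1≤τ))
            (+-monoʳ-≤ (X (a ∷ word P) σ * X (b ∷ word Q) τ) ηM≤ε))
        }
        where
        P⁺ = centred-digits 1≤a P
        Q⁺ = centred-digits 1≤b Q
        IP = hull (state P) (index P)
        IQ = hull (state Q) (index Q)
        aboveP = proj₁ (splits (state P) (index< P))
        aboveQ = proj₁ (splits (state Q) (index< Q))
        nearP : ∀ {σ} → 1ℚ ≤ σ →
          X (a ∷ word P) σ ≤ proj₁ (node-hull a P) + η × proj₂ (node-hull a P) ≤ X (a ∷ word P) σ + η
        nearP = image-near k IP P⁺ (s≤s (size⇒length (k ℕ.+ k) P m≤)) aboveP
        nearQ : ∀ {σ} → 1ℚ ≤ σ →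
          X (b ∷ word Q) σ ≤ proj₁ (node-hull b Q) + η × proj₂ (node-hull b Q) ≤ X (b ∷ word Q) σ + η
        nearQ = image-near k IQ Q⁺ (s≤s (size⇒length (k ℕ.+ k) Q n≤)) aboveQ
        upperP : proj₁ (node-hull a P) ≤ A
        upperP = image-upper a IP (accepts⇒digits after-4 (accepted P)) aboveP
        upperQ : proj₁ (node-hull b Q) ≤ B
        upperQ = image-upper b IQ (accepts⇒digits after-4 (accepted Q)) aboveQ

threshold : ℚ
threshold = + 92 / 5

block : ∀ r ε → threshold ≤ r → 0ℚ < ε → Block r ε
block r ε r≥ 0<ε = go (choose-centre (≤-trans (from-yes (lower-end (4 , 4) ≤? threshold)) r≥))
  where
  go : (∃ λ k → lower-end (centre k) ≤ r × r ≤ upper-end (centre k)) → Block r ε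
  go (zero  , l , u) = block-from 0<ε (centre-valid 0) (inj₁ (refl , refl)) l u
  go (suc k , l , u) = block-from 0<ε (centre-valid (suc k)) (inj₂ (≤-trans
    (from-yes (⌜ 20 ⌝ ≤? lower-end (4 , 5)))
    (≤-trans (*-mono (0≤⌜⌝+ 5 l≥0) (0≤⌜⌝+ b l≥0) (+-monoˡ-≤ (+ 24 / 91) (⌜⌝-mono (Centre.4≤b (centre-valid k))))
      (+-monoˡ-≤ (+ 24 / 91) (⌜⌝-mono (s≤s (Centre.4≤a (centre-valid k)))))) l))) l u
    where
    b = proj₂ (centre k)
    l≥0 = from-yes (0ℚ ≤? + 24 / 91)

-- Products at the other positions of a word

-- Quantifying over σ and τ makes the bound independent of what surrounds the two words.
CutBound : ℚ → List ℕ → List ℕ → Set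
CutBound β l ρ = ∀ {σ τ} → 1ℚ ≤ σ → 1ℚ ≤ τ → X l σ * X ρ τ ≤ β

CutBound-sym : ∀ {β l ρ} → CutBound β l ρ → CutBound β ρ l
CutBound-sym {β} {l} {ρ} h {σ} {τ} 1≤σ 1≤τ = subst (_≤ β) (*-comm (X l τ) (X ρ σ)) (h 1≤τ 1≤σ)

CutBound-weaken : ∀ {β β′ l ρ} → β ≤ β′ → CutBound β l ρ → CutBound β′ l ρ
CutBound-weaken β≤β′ h 1≤σ 1≤τ = ≤-trans (h 1≤σ 1≤τ) β≤β′

-- l is the reversed part of a word before a cut, and m the part after it.
AllCuts : (List ℕ → List ℕ → Set) → List ℕ → List ℕ → Set
AllCuts Φ l []      = Φ l []
AllCuts Φ l (d ∷ m) = Φ l (d ∷ m) × AllCuts Φ (d ∷ l) m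

AllCuts-map : ∀ {Φ Ψ : List ℕ → List ℕ → Set} l m → (∀ {l m} → Φ l m → Ψ l m) → AllCuts Φ l m → AllCuts Ψ l m
AllCuts-map l []      f h       = f h
AllCuts-map l (d ∷ m) f (h , t) = f h , AllCuts-map (d ∷ l) m f t

AllCuts-here : ∀ {Φ : List ℕ → List ℕ → Set} l m → AllCuts Φ l m → Φ l m
AllCuts-here l []      h = h
AllCuts-here l (d ∷ m) h = proj₁ h

-- The digit 2 delimits blocks. It is harmless: next to a digit at most 4 it gives a product of at
-- most 5 · 3.
closed : List ℕ → List ℕ
closed m = m ++ 2 ∷ []

SideCut : ℚ → List ℕ → List ℕ → Set
SideCut β l m = CutBound β l (closed m)

closed-digits : ∀ {s m} → Accepts s m → Digits (closed m)
closed-digits {s} acc = All.++⁺ (accepts⇒digits s acc) (s≤s z≤n ∷ [])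

-- Ensures that the value of the list is at least [1; n + 1], so that a digit d in front of it gives
-- at most [d; 1, n + 1].
data Tame (n : ℕ) : List ℕ → Set where
  large : ∀ {c l} → 2 ℕ.≤ c → Tame n (c ∷ l)
  one   : ∀ {e l} → e ℕ.≤ n → Tame n (1 ∷ e ∷ l)

X-≤suc : ∀ {d n w τ} → d ℕ.≤ n → Digits w → 1ℚ ≤ τ → X (d ∷ w) τ ≤ ⌜ suc n ⌝
X-≤suc {d} {n} d≤n w⁺ 1≤τ = ≤-trans (X-upper d w⁺ 1≤τ)
  (subst (⌜ d ⌝ + 1ℚ ≤_) (sym (⌜suc⌝ n)) (+-monoˡ-≤ 1ℚ (⌜⌝-mono d≤n)))

tame-inv : ∀ {n l τ} → Tame n l → Digits l → 1ℚ ≤ τ → inv (X l τ) ≤ inv (1ℚ + inv ⌜ suc n ⌝)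
tame-inv {n} {c ∷ l} (large 2≤c) (_ ∷ l⁺) 1≤τ = inv-antimono (≤+nonNeg (0≤inv (0≤⌜⌝ (suc n))))
  (≤-trans (+-monoʳ-≤ 1ℚ (inv≤1 (⌜⌝-mono {1} {suc n} (s≤s z≤n)))) (≤-trans (⌜⌝-mono 2≤c) (X-lower c l⁺ 1≤τ)))
tame-inv {n} (one e≤n) (_ ∷ e⁺ ∷ l⁺) 1≤τ = inv-antimono (≤+nonNeg (0≤inv (0≤⌜⌝ (suc n))))
  (+-monoʳ-≤ 1ℚ (inv-antimono (1≤X (e⁺ ∷ l⁺) 1≤τ) (X-≤suc e≤n l⁺ 1≤τ)))

X-tame : ∀ {n} d {l τ} → Tame n l → Digits l → 1ℚ ≤ τ → X (d ∷ l) τ ≤ ⌜ d ⌝ + inv (1ℚ + inv ⌜ suc n ⌝)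
X-tame d t l⁺ 1≤τ = +-monoʳ-≤ ⌜ d ⌝ (tame-inv t l⁺ 1≤τ)

cut-crude : ∀ m n {β c d l ρ} → c ℕ.≤ m → d ℕ.≤ n → ⌜ suc m ⌝ * ⌜ suc n ⌝ ≤ β →
  Digits l → Digits (d ∷ ρ) → CutBound β (c ∷ l) (d ∷ ρ)
cut-crude m n {β} {c} {d} c≤m d≤n ≤β l⁺ (d⁺ ∷ ρ⁺) 1≤σ 1≤τ = ≤-trans
  (*-mono (1≤⇒0≤ (1≤X (d⁺ ∷ ρ⁺) 1≤τ)) (0≤⌜⌝ (suc m)) (X-≤suc c≤m l⁺ 1≤σ) (X-≤suc d≤n ρ⁺ 1≤τ)) ≤β

cut-tame : ∀ m n {β} c d {l ρ} → Tame m l → Tame n ρ →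
  (⌜ c ⌝ + inv (1ℚ + inv ⌜ suc m ⌝)) * (⌜ d ⌝ + inv (1ℚ + inv ⌜ suc n ⌝)) ≤ β →
  Digits l → Digits (d ∷ ρ) → CutBound β (c ∷ l) (d ∷ ρ)
cut-tame m n {β} c d tl tρ ≤β l⁺ (d⁺ ∷ ρ⁺) 1≤σ 1≤τ = ≤-trans
  (*-mono (1≤⇒0≤ (1≤X (d⁺ ∷ ρ⁺) 1≤τ))
    (0≤⌜⌝+ c (0≤inv (+-nonNeg 0≤1 (0≤inv (0≤⌜⌝ (suc m))))))
    (X-tame c tl l⁺ 1≤σ) (X-tame d tρ ρ⁺ 1≤τ)) ≤β

tame-after : ∀ s n → (∀ {d} → d ℕ.≤ suc (top-1 (step s 1)) → d ℕ.≤ n) → 2 ℕ.≤ n →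
  ∀ m → Accepts s m → Tame n (closed m)
tame-after s n _  _   []              _               = large ℕₚ.≤-refl
tame-after s n _  _   (suc (suc d) ∷ m) _             = large (s≤s (s≤s z≤n))
tame-after s n _  2≤n (1 ∷ [])        _               = one 2≤n
tame-after s n ≤n _   (1 ∷ e ∷ m)     (_ , (_ , e≤) , _) = one (≤n e≤)
tame-after s n _  _   (0 ∷ m)         ((() , _) , _)

-- A state constrains the digits still to come, whereas a product at a cut also involves those
-- already read. This relates the two: c is the digit just read and e the one before it. In
-- particular a 3 read after 4, 1 forces `restricted`, and behind any other 3 the list is `Tame 3`.
data History : State → List ℕ → Set where
  history : ∀ {s c e l} → 1 ℕ.≤ c → c ℕ.≤ 4 →
    (c ≡ 4 → s ≡ after-4) →
    (c ≡ 1 → e ℕ.≤ 3 ⊎ (e ≡ 4 × s ≡ after-41)) →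
    (c ≡ 3 → s ≡ restricted ⊎ Tame 3 (e ∷ l)) →
    Tame 4 (e ∷ l) → History s (c ∷ e ∷ l)

history-step : ∀ {s l d} → History s l → 1 ℕ.≤ d → d ℕ.≤ suc (top-1 s) → History (step s d) (d ∷ l)
history-step {s} {c ∷ e ∷ l} {d} (history 1≤c c≤4 c4 c1 c3 t) 1≤d d≤ =
  history 1≤d (ℕₚ.≤-trans d≤ (s≤s (top-1≤3 s)))
    (λ { refl → step-4 s d≤ })
    (λ { refl → to-1 c≤4 c4 })
    (λ { refl → to-3 c 1≤c c1 })
    (to-tame c 1≤c c1)
  where
  to-1 : ∀ {c} → c ℕ.≤ 4 → (c ≡ 4 → s ≡ after-4) → c ℕ.≤ 3 ⊎ (c ≡ 4 × step s 1 ≡ after-41)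
  to-1 c≤4 c4 with ℕₚ.m≤n⇒m<n∨m≡n c≤4
  ... | inj₁ (s≤s c≤3) = inj₁ c≤3
  ... | inj₂ c≡4       = inj₂ (c≡4 , cong (λ s → step s 1) (c4 c≡4))
  to-3 : ∀ c → 1 ℕ.≤ c → (c ≡ 1 → e ℕ.≤ 3 ⊎ (e ≡ 4 × s ≡ after-41)) → step s 3 ≡ restricted ⊎ Tame 3 (c ∷ e ∷ l)
  to-3 (suc (suc c)) _ _ = inj₂ (large (s≤s (s≤s z≤n)))
  to-3 1 _ c1 with c1 refl
  ... | inj₁ e≤3       = inj₂ (one e≤3)
  ... | inj₂ (_ , s≡) = inj₁ (cong (λ s → step s 3) s≡)
  to-tame : ∀ c → 1 ℕ.≤ c → (c ≡ 1 → e ℕ.≤ 3 ⊎ (e ≡ 4 × s ≡ after-41)) → Tame 4 (c ∷ e ∷ l)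
  to-tame (suc (suc c)) _ _ = large (s≤s (s≤s z≤n))
  to-tame 1 _ c1 with c1 refl
  ... | inj₁ e≤3       = one (ℕₚ.m≤n⇒m≤1+n e≤3)
  ... | inj₂ (e≡4 , _) = one (ℕₚ.≤-reflexive e≡4)

history-cut : ∀ {s l} m → History s l → Digits l → Accepts s m → SideCut threshold l m
history-cut [] (history _ c≤4 _ _ _ _) (_ ∷ l⁺) _ =
  cut-crude 4 2 c≤4 ℕₚ.≤-refl (from-yes (⌜ 5 ⌝ * ⌜ 3 ⌝ ≤? threshold)) l⁺ (s≤s z≤n ∷ [])
history-cut {s} (d ∷ m) (history {c = c} {e} {l} 1≤c c≤4 c4 c1 c3 t) (_ ∷ l⁺) ((1≤d , d≤) , acc) =
  go c d c≤4 (ℕₚ.≤-trans d≤ (s≤s (top-1≤3 s))) c4 c3 (1≤d ∷ closed-digits acc) d≤ acc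
  where
  go : ∀ c d → c ℕ.≤ 4 → d ℕ.≤ 4 → (c ≡ 4 → s ≡ after-4) → (c ≡ 3 → s ≡ restricted ⊎ Tame 3 (e ∷ l)) →
    Digits (d ∷ closed m) → d ℕ.≤ suc (top-1 s) → Accepts (step s d) m →
    CutBound threshold (c ∷ e ∷ l) (d ∷ closed m)
  three-four : s ≡ restricted ⊎ Tame 3 (e ∷ l) → Digits (4 ∷ closed m) → 4 ℕ.≤ suc (top-1 s) →
    Accepts (step s 4) m → CutBound threshold (3 ∷ e ∷ l) (4 ∷ closed m)
  -- After 413 the digit 4 is refused; this is the use of forbidding 4134. Otherwise the product is
  -- at most [3; 1, 4] · [4; 1, 5] = 551/30 < 92/5.
  three-four (inj₁ refl) _  (s≤s (s≤s (s≤s ()))) _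
  three-four (inj₂ t₃)   ρ⁺ _  acc = cut-tame 3 4 3 4 t₃
    (tame-after (step s 4) 4 (λ d≤ → ℕₚ.≤-trans d≤ (s≤s (top-1≤3 (step (step s 4) 1)))) (s≤s (s≤s z≤n)) m acc)
    (from-yes ((⌜ 3 ⌝ + inv (1ℚ + inv ⌜ 4 ⌝)) * (⌜ 4 ⌝ + inv (1ℚ + inv ⌜ 5 ⌝)) ≤? threshold)) l⁺ ρ⁺
  four-three : s ≡ after-4 → Digits (3 ∷ closed m) → Accepts (step s 3) m →
    CutBound threshold (4 ∷ e ∷ l) (3 ∷ closed m)
  -- Since 4314 is forbidden, a 1 after 43 is followed by at most 3, and the same bound 551/30
  -- results.
  four-three refl ρ⁺ acc = cut-tame 4 3 4 3 t
    (tame-after after-43 3 (λ d≤ → d≤) (s≤s (s≤s z≤n)) m acc)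
    (from-yes ((⌜ 4 ⌝ + inv (1ℚ + inv ⌜ 5 ⌝)) * (⌜ 3 ⌝ + inv (1ℚ + inv ⌜ 4 ⌝)) ≤? threshold)) l⁺ ρ⁺
  four-four : s ≡ after-4 → ¬ (4 ℕ.≤ suc (top-1 s))
  four-four refl (s≤s (s≤s (s≤s ())))
  go 4 3 _ _ c4 _ ρ⁺ _ acc = four-three (c4 refl) ρ⁺ acc
  go 4 4 _ _ c4 _ _ d≤ _ = ⊥-elim (four-four (c4 refl) d≤)
  go 4 0 c≤4 _ _ _ ρ⁺ _ _ = cut-crude 4 2 c≤4 z≤n (from-yes (⌜ 5 ⌝ * ⌜ 3 ⌝ ≤? threshold)) l⁺ ρ⁺
  go 4 1 c≤4 _ _ _ ρ⁺ _ _ = cut-crude 4 2 c≤4 (s≤s z≤n) (from-yes (⌜ 5 ⌝ * ⌜ 3 ⌝ ≤? threshold)) l⁺ ρ⁺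
  go 4 2 c≤4 _ _ _ ρ⁺ _ _ = cut-crude 4 2 c≤4 ℕₚ.≤-refl (from-yes (⌜ 5 ⌝ * ⌜ 3 ⌝ ≤? threshold)) l⁺ ρ⁺
  go 3 4 _ _ _ c3 ρ⁺ d≤ acc = three-four (c3 refl) ρ⁺ d≤ acc
  go 0 d _ d≤4 _ _ ρ⁺ _ _ = cut-crude 2 4 z≤n d≤4 (from-yes (⌜ 3 ⌝ * ⌜ 5 ⌝ ≤? threshold)) l⁺ ρ⁺
  go 1 d _ d≤4 _ _ ρ⁺ _ _ = cut-crude 2 4 (s≤s z≤n) d≤4 (from-yes (⌜ 3 ⌝ * ⌜ 5 ⌝ ≤? threshold)) l⁺ ρ⁺
  go 2 d _ d≤4 _ _ ρ⁺ _ _ = cut-crude 2 4 ℕₚ.≤-refl d≤4 (from-yes (⌜ 3 ⌝ * ⌜ 5 ⌝ ≤? threshold)) l⁺ ρ⁺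
  go 3 0 _ _ _ _ ρ⁺ _ _ = cut-crude 3 3 ℕₚ.≤-refl z≤n (from-yes (⌜ 4 ⌝ * ⌜ 4 ⌝ ≤? threshold)) l⁺ ρ⁺
  go 3 1 _ _ _ _ ρ⁺ _ _ = cut-crude 3 3 ℕₚ.≤-refl (s≤s z≤n) (from-yes (⌜ 4 ⌝ * ⌜ 4 ⌝ ≤? threshold)) l⁺ ρ⁺
  go 3 2 _ _ _ _ ρ⁺ _ _ = cut-crude 3 3 ℕₚ.≤-refl (s≤s (s≤s z≤n)) (from-yes (⌜ 4 ⌝ * ⌜ 4 ⌝ ≤? threshold)) l⁺ ρ⁺
  go 3 3 _ _ _ _ ρ⁺ _ _ = cut-crude 3 3 ℕₚ.≤-refl ℕₚ.≤-refl (from-yes (⌜ 4 ⌝ * ⌜ 4 ⌝ ≤? threshold)) l⁺ ρ⁺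
  go (suc (suc (suc (suc (suc _))))) _ (s≤s (s≤s (s≤s (s≤s ())))) _ _ _ _ _ _
  go 3 (suc (suc (suc (suc (suc _))))) _ (s≤s (s≤s (s≤s (s≤s ())))) _ _ _ _ _
  go 4 (suc (suc (suc (suc (suc _))))) _ (s≤s (s≤s (s≤s (s≤s ())))) _ _ _ _ _

history-cuts : ∀ {s l} m → History s l → Digits l → Accepts s m → AllCuts (SideCut threshold) l m
history-cuts []      h l⁺ acc = history-cut [] h l⁺ acc
history-cuts (d ∷ m) h l⁺ acc@((1≤d , d≤) , acc′) =
  history-cut (d ∷ m) h l⁺ acc , history-cuts m (history-step h 1≤d d≤) (1≤d ∷ l⁺) acc′

-- As 44 does not occur, one of the two digits at a cut is at most 3 and the product is at most 4 ·
-- 5.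
coarse-cuts : ∀ {β s c l} m → ⌜ 20 ⌝ ≤ β → c ℕ.≤ 4 → (c ≡ 4 → s ≡ after-4) → Digits (c ∷ l) → Accepts s m →
  AllCuts (SideCut β) (c ∷ l) m
coarse-cuts [] 20≤ c≤4 _ (_ ∷ l⁺) _ =
  cut-crude 4 2 c≤4 ℕₚ.≤-refl (≤-trans (from-yes (⌜ 5 ⌝ * ⌜ 3 ⌝ ≤? ⌜ 20 ⌝)) 20≤) l⁺ (s≤s z≤n ∷ [])
coarse-cuts {β} {s} {c} {l} (d ∷ m) 20≤ c≤4 c4 (c⁺ ∷ l⁺) ((1≤d , d≤) , acc) =
  here (ℕₚ.m≤n⇒m<n∨m≡n c≤4) ,
  coarse-cuts m 20≤ d≤4 (λ { refl → step-4 s d≤ }) (1≤d ∷ c⁺ ∷ l⁺) acc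
  where
  d≤4 : d ℕ.≤ 4
  d≤4 = ℕₚ.≤-trans d≤ (s≤s (top-1≤3 s))
  here : c ℕ.< 4 ⊎ c ≡ 4 → CutBound β (c ∷ l) (d ∷ closed m)
  here (inj₁ (s≤s c≤3)) = cut-crude 3 4 c≤3 d≤4
    (≤-trans (from-yes (⌜ 4 ⌝ * ⌜ 5 ⌝ ≤? ⌜ 20 ⌝)) 20≤) l⁺ (1≤d ∷ closed-digits acc)
  here (inj₂ c≡4) = cut-crude 4 3 c≤4 (subst (λ s → d ℕ.≤ suc (top-1 s)) (c4 c≡4) d≤)
    (≤-trans (from-yes (⌜ 5 ⌝ * ⌜ 4 ⌝ ≤? ⌜ 20 ⌝)) 20≤) l⁺ (1≤d ∷ closed-digits acc)

-- The factor starting with a, b is at most a + 1/4 because b ≥ 4. The other one starts with a digit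
-- at most 3, so it is at most 4 ≤ b.
cut-adjacent : ∀ {β a b l} m → 4 ℕ.≤ a → 4 ℕ.≤ b → (⌜ a ⌝ + + 1 / 4) * (⌜ b ⌝ + + 1 / 4) ≤ β → Digits l →
  Accepts after-4 m → SideCut β (a ∷ b ∷ l) m
cut-adjacent {β} {a} {b} {l} m 4≤a 4≤b ≤β l⁺ acc {σ} {τ} 1≤σ 1≤τ = ≤-trans
  (*-mono (1≤⇒0≤ (1≤X (closed-digits acc) 1≤τ)) (0≤⌜⌝+ a ¼≥0)
    (+-monoʳ-≤ ⌜ a ⌝ (inv-antimono (⌜⌝-mono {1} {4} (s≤s z≤n)) (≤-trans (⌜⌝-mono 4≤b) (X-lower b l⁺ 1≤σ))))
    (≤-trans (outer m acc) (≤-trans (⌜⌝-mono 4≤b) (≤+nonNeg {⌜ b ⌝} {+ 1 / 4} ¼≥0)))) ≤β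
  where
  ¼≥0 = from-yes (0ℚ ≤? + 1 / 4)
  outer : ∀ m → Accepts after-4 m → X (closed m) τ ≤ ⌜ 4 ⌝
  outer []      _                 = X-≤suc {2} {3} {[]} (s≤s (s≤s z≤n)) [] 1≤τ
  outer (d ∷ m) ((_ , d≤) , acc) = X-≤suc {d} {3} {closed m} d≤ (closed-digits acc) 1≤τ

side-cuts : ∀ {β a b l} m → (a ≡ 4 × b ≡ 4) ⊎ ⌜ 20 ⌝ ≤ β → threshold ≤ β → 4 ℕ.≤ a → 4 ℕ.≤ b →
  (⌜ a ⌝ + + 1 / 4) * (⌜ b ⌝ + + 1 / 4) ≤ β → Digits l → Accepts after-4 m → AllCuts (SideCut β) (a ∷ b ∷ l) m
side-cuts {β} {l = l} m (inj₁ (refl , refl)) ≤β _ _ _ l⁺ acc =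
  AllCuts-map (4 ∷ 4 ∷ l) m (λ {l} {m} → CutBound-weaken {l = l} {closed m} ≤β)
    (history-cuts m (history (s≤s z≤n) ℕₚ.≤-refl (λ _ → refl) (λ ()) (λ ()) (large (s≤s (s≤s z≤n))))
      (s≤s z≤n ∷ s≤s z≤n ∷ l⁺) acc)
side-cuts []      (inj₂ _)   _ 4≤a 4≤b ≤β l⁺ acc = cut-adjacent [] 4≤a 4≤b ≤β l⁺ acc
side-cuts {a = a} {b} (d ∷ m) (inj₂ 20≤) _ 4≤a 4≤b ≤β l⁺ acc@((1≤d , d≤) , acc′) =
  cut-adjacent (d ∷ m) 4≤a 4≤b ≤β l⁺ acc ,
  coarse-cuts m 20≤ (ℕₚ.m≤n⇒m≤1+n d≤) (λ { refl → ⊥-elim (ℕₚ.<⇒≱ (ℕₚ.n<1+n 3) d≤) })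
    (1≤d ∷ ℕₚ.≤-trans (s≤s z≤n) 4≤a ∷ ℕₚ.≤-trans (s≤s z≤n) 4≤b ∷ l⁺) acc′

-- Both sides of a block are analysed outwards from the centre. The product at a cut is symmetric,
-- so the bounds for v can be read from its far end as well.
mirror-cuts : ∀ {β} v m → AllCuts (SideCut β) (closed m) v → AllCuts (SideCut β) (closed v) m →
  AllCuts (SideCut β) (2 ∷ []) (v List.ʳ++ m)
mirror-cuts []      m _       rest = rest
mirror-cuts (d ∷ v) m (_ , h) rest = mirror-cuts v (d ∷ m) h
  (CutBound-sym {l = d ∷ closed m} {closed v} (AllCuts-here (d ∷ closed m) v h) , rest)

block-word : ∀ {r ε} → Block r ε → List ℕ
block-word B = v List.ʳ++ (a ∷ b ∷ w)
  where open Block B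

block-cuts : ∀ {r ε} → threshold ≤ r → 0ℚ ≤ ε → (B : Block r ε) → AllCuts (SideCut (r + ε)) (2 ∷ []) (block-word B)
block-cuts {r} {ε} ≤r 0≤ε B = mirror-cuts v (a ∷ b ∷ w)
  left
  ( CutBound-sym {l = closed (a ∷ b ∷ w)} {closed v} (AllCuts-here (closed (a ∷ b ∷ w)) v left)
  , centre-cut
  , weaken (b ∷ a ∷ closed v) w (side-cuts w (swap-small small) ≤r 4≤b 4≤a
      (subst (_≤ r) (*-comm (⌜ a ⌝ + + 1 / 4) (⌜ b ⌝ + + 1 / 4)) adjacent) (closed-digits v-accept) w-accept) )
  where
  open Block B
  weaken : ∀ l m → AllCuts (SideCut r) l m → AllCuts (SideCut (r + ε)) l m
  weaken l m = AllCuts-map l m (λ {l} {m} → CutBound-weaken {l = l} {closed m} (≤+nonNeg 0≤ε))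
  swap-small : (a ≡ 4 × b ≡ 4) ⊎ ⌜ 20 ⌝ ≤ r → (b ≡ 4 × a ≡ 4) ⊎ ⌜ 20 ⌝ ≤ r
  swap-small (inj₁ (p , q)) = inj₁ (q , p)
  swap-small (inj₂ h)       = inj₂ h
  left : AllCuts (SideCut (r + ε)) (closed (a ∷ b ∷ w)) v
  left = weaken (closed (a ∷ b ∷ w)) v (side-cuts v small ≤r 4≤a 4≤b adjacent (closed-digits w-accept) v-accept)
  centre-cut : SideCut (r + ε) (a ∷ closed v) (b ∷ w)
  centre-cut {σ} {τ} 1≤σ 1≤τ = subst₂ (λ x y → x * y ≤ r + ε)
    (sym (X-++ (a ∷ v) (2 ∷ []) σ)) (sym (X-++ (b ∷ w) (2 ∷ []) τ))
    (product≤ (1≤X {2 ∷ []} (s≤s z≤n ∷ []) 1≤σ) (1≤X {2 ∷ []} (s≤s z≤n ∷ []) 1≤τ))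

-- Concatenating blocks

record Config : Set where
  constructor ⟨_,_,_⟩
  field
    stage    : ℕ
    backward : List ℕ
    forward  : List ℕ

open Config public

digit : Config → ℕ
digit ⟨ _ , []    , _ ⟩ = 2
digit ⟨ _ , d ∷ _ , _ ⟩ = d

⟦⟧-X : ∀ w o os → ⟦ map +_ (w ++ o ∷ os) ⟧ ≡ X w ⟦ map +_ (o ∷ os) ⟧
⟦⟧-X []          o os = refl
⟦⟧-X (d ∷ [])    o os = refl
⟦⟧-X (d ∷ e ∷ w) o os = cong (λ x → ⌜ d ⌝ + inv x) (⟦⟧-X (e ∷ w) o os)

1≤⟦⟧ : ∀ {o os} → Digits (o ∷ os) → 1ℚ ≤ ⟦ map +_ (o ∷ os) ⟧
1≤⟦⟧ {o} {[]}     (o⁺ ∷ _)     = ⌜⌝-mono o⁺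
1≤⟦⟧ {o} {_ ∷ os} (o⁺ ∷ os⁺) = ≤-trans (⌜⌝-mono o⁺) (≤+nonNeg (0≤inv (1≤⇒0≤ (1≤⟦⟧ os⁺))))

convergent-cong : ∀ {x y : ℕ → ℤ} n → (∀ i → x i ≡ y i) → convergent x n ≡ convergent y n
convergent-cong zero    x≗y = cong (_/ 1) (x≗y 0)
convergent-cong (suc n) x≗y = cong₂ (λ z c → z / 1 + inv c) (x≗y 0) (convergent-cong n (x≗y ∘ suc))

-- The sequence 2, 2, word 0, 2, word 1, 2, word 2, …
module Concatenation (word : ℕ → List ℕ) (word⁺ : ∀ k → Digits (word k)) where

  next : Config → Config
  next ⟨ k , l , []    ⟩ = ⟨ suc k , 2 ∷ [] , word (suc k) ⟩
  next ⟨ k , l , d ∷ m ⟩ = ⟨ k , d ∷ l , m ⟩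

  block-start : ℕ → Config
  block-start k = ⟨ k , 2 ∷ [] , word k ⟩

  config : ℕ → Config
  config zero    = block-start 0
  config (suc n) = next (config n)

  iterate : ℕ → Config → Config
  iterate zero    c = c
  iterate (suc i) c = iterate i (next c)

  next-iterate : ∀ i c → next (iterate i c) ≡ iterate i (next c)
  next-iterate zero    c = refl
  next-iterate (suc i) c = next-iterate i (next c)

  config-+ : ∀ i n → config (i ℕ.+ n) ≡ iterate i (config n)
  config-+ zero    n = refl
  config-+ (suc i) n = trans (cong next (config-+ i n)) (next-iterate i (config n))

  iterate-preserves : ∀ (Φ : Config → Set) → (∀ c → Φ c → Φ (next c)) → ∀ i {c} → Φ c → Φ (iterate i c)
  iterate-preserves Φ step zero    h = h
  iterate-preserves Φ step (suc i) h = iterate-preserves Φ step i (step _ h)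

  Positive-config : Config → Set
  Positive-config c = Digits (backward c) × Digits (forward c)

  next-positive : ∀ c → Positive-config c → Positive-config (next c)
  next-positive ⟨ k , l , []    ⟩ _               = s≤s z≤n ∷ [] , word⁺ (suc k)
  next-positive ⟨ k , l , d ∷ m ⟩ (l⁺ , d⁺ ∷ m⁺) = d⁺ ∷ l⁺ , m⁺

  config-positive : ∀ n → Positive-config (config n)
  config-positive zero    = s≤s z≤n ∷ [] , word⁺ 0
  config-positive (suc n) = next-positive (config n) (config-positive n)

  digit-positive : ∀ c → Positive-config c → 0ℤ ℤ.< + digit c
  digit-positive ⟨ _ , []    , _ ⟩ _              = ℤ.+<+ (s≤s z≤n)
  digit-positive ⟨ _ , d ∷ _ , _ ⟩ (d⁺ ∷ _ , _) = ℤ.+<+ d⁺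

  sequence : ℕ → ℤ
  -- This additional 2 lies before the delimiter of block 0, so that the past beyond `backward` is
  -- never empty and σ always exists.
  sequence zero    = + 2
  sequence (suc n) = + digit (config n)

  cf : RegularCF
  cf = mkCF sequence λ n → digit-positive (config n) (config-positive n)

  -- `backward` goes back only to the last delimiter. The remaining digits o ∷ os are forgotten
  -- except for their value, which becomes σ.
  Past : Config → List ℤ → Set
  Past c zs = ∃₂ λ o os → Digits (o ∷ os) × zs ≡ map +_ (backward c ++ o ∷ os)

  next-past : ∀ c {zs} → Positive-config c → Past c zs → Past (next c) (+ digit (next c) ∷ zs)
  next-past ⟨ k , []    , []    ⟩ _         (o , os , os⁺ , eq) = o , os , os⁺ , cong (+ 2 ∷_) eq
  next-past ⟨ k , d ∷ l , []    ⟩ (l⁺ , _) (o , os , os⁺ , eq) =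
    d , l ++ o ∷ os , All.++⁺ l⁺ os⁺ , cong (+ 2 ∷_) eq
  next-past ⟨ k , l     , d ∷ m ⟩ _         (o , os , os⁺ , eq) = o , os , os⁺ , cong (+ d ∷_) eq

  config-past : ∀ n → Past (config n) (applyDownFrom (sequence ∘ suc) (suc n) ++ + 2 ∷ [])
  config-past zero    = 2 , [] , s≤s z≤n ∷ [] , refl
  config-past (suc n) = next-past (config n) (config-positive n) (config-past n)

  reversed-X : ∀ n → ∃ λ σ → 1ℚ ≤ σ × reversed cf (suc n) ≡ X (backward (config n)) σ
  reversed-X n = let o , os , os⁺ , eq = config-past n in
    ⟦ map +_ (o ∷ os) ⟧ , 1≤⟦⟧ os⁺ , trans (cong ⟦_⟧ eq) (⟦⟧-X (backward (config n)) o os)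

  convergent-X : ∀ c → Positive-config c → ∀ j → length (forward c) ℕ.≤ j →
    ∃ λ τ → 1ℚ ≤ τ × convergent (λ i → + digit (iterate i (next c))) (suc j) ≡ X (closed (forward c)) τ
  convergent-X c@(⟨ k , l , [] ⟩) c⁺ j _ = convergent (λ i → + digit (iterate (suc i) (next c))) j ,
    1≤convergent _ j (λ i → digit-positive (iterate (suc i) (next c))
      (iterate-preserves Positive-config next-positive (suc i) (next-positive c c⁺))) , refl
  convergent-X c@(⟨ k , l , d ∷ m ⟩) c⁺ (suc j) (s≤s h) =
    let τ , 1≤τ , eq = convergent-X (next c) (next-positive c c⁺) j h in
    τ , 1≤τ , cong (λ x → ⌜ d ⌝ + inv x) eq

  product-X : ∀ n → ∃ λ σ → 1ℚ ≤ σ × (∀ j → length (forward (config n)) ℕ.< j → ∃ λ τ → 1ℚ ≤ τ ×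
    reversed cf (suc n) * convergent (quotient (tailFrom (suc (suc n)) cf)) j ≡
    X (backward (config n)) σ * X (closed (forward (config n))) τ)
  product-X n = let σ , 1≤σ , eq = reversed-X n in σ , 1≤σ , after eq
    where
    after : ∀ {σ} → reversed cf (suc n) ≡ X (backward (config n)) σ →
      ∀ j → length (forward (config n)) ℕ.< j → ∃ λ τ → 1ℚ ≤ τ ×
      reversed cf (suc n) * convergent (quotient (tailFrom (suc (suc n)) cf)) j ≡
      X (backward (config n)) σ * X (closed (forward (config n))) τ
    after eq (suc j) (s≤s h) = let τ , 1≤τ , eq′ = convergent-X (config n) (config-positive n) j h in
      τ , 1≤τ , cong₂ _*_ eq (trans (convergent-cong (suc j) shift) eq′)
      where
      shift : ∀ i → quotient (tailFrom (suc (suc n)) cf) i ≡ + digit (iterate i (next (config n)))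
      shift i = trans (cong sequence (ℕₚ.+-suc i (suc n))) (cong (λ c → + digit c) (config-+ i (suc n)))

  next-cuts : ∀ {Φ : ℕ → List ℕ → List ℕ → Set} → (∀ k → AllCuts (Φ k) (2 ∷ []) (word k)) →
    ∀ c → AllCuts (Φ (stage c)) (backward c) (forward c) →
    AllCuts (Φ (stage (next c))) (backward (next c)) (forward (next c))
  next-cuts cuts ⟨ k , l , []    ⟩ _       = cuts (suc k)
  next-cuts cuts ⟨ k , l , d ∷ m ⟩ (_ , h) = h

  config-cut : ∀ {Φ : ℕ → List ℕ → List ℕ → Set} → (∀ k → AllCuts (Φ k) (2 ∷ []) (word k)) →
    ∀ n → Φ (stage (config n)) (backward (config n)) (forward (config n))
  config-cut {Φ} cuts n = AllCuts-here (backward (config n)) (forward (config n)) (go n)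
    where
    go : ∀ n → AllCuts (Φ (stage (config n))) (backward (config n)) (forward (config n))
    go zero    = cuts 0
    go (suc n) = next-cuts {Φ} cuts (config n) (go n)

  iterate-walk : ∀ m {k l m′} → iterate (length m) ⟨ k , l , m ++ m′ ⟩ ≡ ⟨ k , m List.ʳ++ l , m′ ⟩
  iterate-walk []      = refl
  iterate-walk (d ∷ m) = iterate-walk m

  block-starts : ∀ k → ∃ λ n → k ℕ.≤ n × config n ≡ block-start k
  block-starts zero    = 0 , z≤n , refl
  block-starts (suc k) = let n , k≤n , eq = block-starts k in
    suc (length (word k) ℕ.+ n) , s≤s (ℕₚ.≤-trans k≤n (ℕₚ.m≤n+m n (length (word k)))) ,
    cong next (trans (config-+ (length (word k)) n) (trans (cong (iterate (length (word k))) eq)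
      (trans (cong (λ m → iterate (length (word k)) ⟨ k , 2 ∷ [] , m ⟩) (sym (Listₚ.++-identityʳ (word k))))
        (iterate-walk (word k)))))

  centres : ∀ k {v m} → word k ≡ v List.ʳ++ m → ∃ λ n → k ℕ.≤ n × config n ≡ ⟨ k , closed v , m ⟩
  centres k {v} {m} eq = let n , k≤n , eq′ = block-starts k in
    length (reverse v) ℕ.+ n , ℕₚ.≤-trans k≤n (ℕₚ.m≤n+m n (length (reverse v))) ,
    trans (config-+ (length (reverse v)) n) (trans (cong (iterate (length (reverse v)))
      (trans eq′ (cong (λ m → ⟨ k , 2 ∷ [] , m ⟩) (trans eq (Listₚ.ʳ++-defn v)))))
      (trans (iterate-walk (reverse v)) (cong (λ l → ⟨ k , l , m ⟩)
        (trans (Listₚ.ʳ++-defn (reverse v)) (cong (_++ 2 ∷ []) (Listₚ.reverse-involutive v))))))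

  stage-next : ∀ k c → k ℕ.≤ stage c → k ℕ.≤ stage (next c)
  stage-next k ⟨ _ , _ , []    ⟩ h = ℕₚ.m≤n⇒m≤1+n h
  stage-next k ⟨ _ , _ , _ ∷ _ ⟩ h = h

  stage-unbounded : ∀ k → ∃ λ N → ∀ n → N ℕ.≤ n → k ℕ.≤ stage (config n)
  stage-unbounded k = let N , _ , eq = block-starts k in N , λ n N≤n →
    subst (λ n → k ℕ.≤ stage (config n)) (ℕₚ.m∸n+n≡m N≤n)
      (subst (λ c → k ℕ.≤ stage c) (sym (config-+ (n ℕ.∸ N) N))
        (iterate-preserves (λ c → k ℕ.≤ stage c) (stage-next k) (n ℕ.∸ N)
          (subst (λ c → k ℕ.≤ stage c) (sym eq) ℕₚ.≤-refl)))

-- Irrationality of infinite continued fractions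

Limit : (ℕ → ℤ) → ℚ → Set
Limit x r = ∀ ε → 0ℚ < ε → ∃ λ N → ∀ n → N ℕ.≤ n → ∣ convergent x n - r ∣ < ε

Positives : (ℕ → ℤ) → Set
Positives x = ∀ i → 0ℤ ℤ.< x (suc i)

module _ (x : ℕ → ℤ) (x⁺ : Positives x) {r : ℚ} (lim : Limit x r) where

  private
    B : ℚ
    B = x 1 / 1 + 1ℚ
    1≤B : 1ℚ ≤ B
    1≤B = ≤-trans (1≤int (x⁺ 0)) (≤+nonNeg {x 1 / 1} 0≤1)
    1≤tail : ∀ n → 1ℚ ≤ convergent (x ∘ suc) n
    1≤tail n = 1≤convergent (x ∘ suc) n x⁺
    tail≤B : ∀ n → convergent (x ∘ suc) n ≤ B
    tail≤B n = convergent-upper (x ∘ suc) n (x⁺ ∘ suc)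

  -- The inequality is strict because every convergent after the first exceeds x₀ by at least 1/B,
  -- where B = x₁ + 1 bounds the tails.
  x₀<limit : x 0 / 1 < r
  x₀<limit = ≰⇒> λ r≤x₀ → let N , h = lim (inv B) (inv-positive 1≤B) in
    <-irrefl refl (<-≤-trans (h (suc N) (ℕₚ.n≤1+n N)) (begin
      inv B                              ≤⟨ inv-antimono (1≤tail N) (tail≤B N) ⟩
      inv (convergent (x ∘ suc) N)       ≡⟨ lemma (x 0 / 1) (inv (convergent (x ∘ suc) N)) ⟨
      convergent x (suc N) - x 0 / 1     ≤⟨ +-monoʳ-≤ (convergent x (suc N)) (neg-antimono-≤ r≤x₀) ⟩
      convergent x (suc N) - r           ≤⟨ p≤∣p∣ (convergent x (suc N) - r) ⟩
      ∣ convergent x (suc N) - r ∣       ∎))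
    where
    open ≤-Reasoning
    open +-*-Solver
    lemma : ∀ a y → a + y - a ≡ y
    lemma = solve 2 (λ a y → a :+ y :- a := y) refl

  tail-limit : ∀ {s} → 0ℚ < s → (r - x 0 / 1) * s ≡ 1ℚ → Limit (x ∘ suc) s
  tail-limit {s} 0<s ds≡1 ε 0<ε =
    let δ , 0<δ , small = small-factor (B * s) ε (*-pos (1≤⇒0< 1≤B) 0<s) 0<ε
        N , h = lim δ 0<δ
    in N , λ n N≤n → subst (_< ε) (cong ∣_∣ (sym (expand n)))
      (small (- (convergent (x ∘ suc) n * s)) (convergent x (suc n) - r)
        (subst (_≤ B * s) (sym (abs n)) (*-monoʳ s (<⇒≤ 0<s) (tail≤B n)))
        (h (suc n) (ℕₚ.m≤n⇒m≤1+n N≤n)))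
    where
    abs : ∀ n → ∣ - (convergent (x ∘ suc) n * s) ∣ ≡ convergent (x ∘ suc) n * s
    abs n = trans (∣-p∣≡∣p∣ (convergent (x ∘ suc) n * s)) (0≤p⇒∣p∣≡p (*-nonNeg (1≤⇒0≤ (1≤tail n)) (<⇒≤ 0<s)))
    expand : ∀ n → convergent (x ∘ suc) n - s ≡ - (convergent (x ∘ suc) n * s) * (convergent x (suc n) - r)
    expand n = begin
      c - s                                ≡⟨ cong₂ _-_ (*-identityʳ c) (*-identityʳ s) ⟨
      c * 1ℚ - s * 1ℚ                      ≡⟨ cong₂ (λ y z → c * y - s * z) (sym ds≡1) (sym (*-inv (1≤tail n))) ⟩
      c * ((r - a) * s) - s * (c * inv c)  ≡⟨ factor c s r a (inv c) ⟩
      - (c * s) * (a + inv c - r)          ∎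
      where
      open ≡-Reasoning
      open +-*-Solver
      c = convergent (x ∘ suc) n
      a = x 0 / 1
      factor : ∀ c s r a y → c * ((r - a) * s) - s * (c * y) ≡ - (c * s) * (a + y - r)
      factor = solve 5 (λ c s r a y →
        c :* ((r :- a) :* s) :- s :* (c :* y) := :- (c :* s) :* (a :+ y :- r)) refl

-- The denominators of the complete quotients of a rational limit would decrease forever.
no-rational-limit : ∀ fuel M → M ℕ.≤ fuel → ∀ x → Positives x → ∀ {r} (N : ℤ) →
  r * (+ M / 1) ≡ N / 1 → 0ℤ ℤ.< + M → ¬ Limit x r
no-rational-limit zero zero _ _ _ _ _ (ℤ.+<+ ()) _
no-rational-limit (suc fuel) M M≤ x x⁺ {r} N rM≡N 0<M lim = descend N′ refl
  where
  a d s m : ℚ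
  a = x 0 / 1
  d = r - a
  m = + M / 1
  0<d : 0ℚ < d
  0<d = subst (_< d) (+-inverseʳ a) (+-monoˡ-< (- a) (x₀<limit x x⁺ lim))
  instance
    d-nonZero = ≢-nonZero {d} λ d≡0 → <-irrefl (sym d≡0) 0<d
    d-positive = positive 0<d
  s = 1/ d
  ds≡1 : d * s ≡ 1ℚ
  ds≡1 = *-inverseʳ d
  0<s : 0ℚ < s
  0<s = positive⁻¹ s {{1/pos⇒pos d}}
  lim′ : Limit (x ∘ suc) s
  lim′ = tail-limit x x⁺ lim 0<s ds≡1
  1<s : 1ℚ < s
  1<s = ≤-<-trans (1≤int (x⁺ 0)) (x₀<limit (x ∘ suc) (x⁺ ∘ suc) lim′)
  0<m : 0ℚ < m
  0<m = <-≤-trans (positive⁻¹ 1ℚ) (1≤int 0<M)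
  d<1 : d < 1ℚ
  d<1 = subst₂ _<_ (*-identityʳ d) ds≡1 (*-monoʳ-<-pos d 1<s)
  N′ : ℤ
  N′ = N ℤ.+ ℤ.- x 0 ℤ.* + M
  dm≡N′ : d * m ≡ N′ / 1
  dm≡N′ = begin
    d * m                                 ≡⟨ solve 3 (λ r a m → (r :- a) :* m := r :* m :+ :- a :* m) refl r a m ⟩
    r * m + - a * m                       ≡⟨ cong₂ _+_ rM≡N (cong (_* m) -a≡) ⟩
    N / 1 + (ℤ.- x 0 / 1) * m             ≡⟨ cong (λ z → N / 1 + z) (/1-homo-* (ℤ.- x 0) (+ M)) ⟨
    N / 1 + (ℤ.- x 0 ℤ.* + M) / 1         ≡⟨ /1-homo-+ N (ℤ.- x 0 ℤ.* + M) ⟨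
    N′ / 1                                ∎
    where
    open ≡-Reasoning
    open +-*-Solver
    neg : ∀ a b → a + b ≡ 0ℚ → - a ≡ b
    neg a b h = trans (sym (+-identityʳ (- a))) (trans (cong (λ z → - a + z) (sym h))
      (solve 2 (λ a b → :- a :+ (a :+ b) := b) refl a b))
    -a≡ : - a ≡ ℤ.- x 0 / 1
    -a≡ = neg a (ℤ.- x 0 / 1)
      (trans (sym (/1-homo-+ (x 0) (ℤ.- x 0))) (cong (_/ 1) (ℤₚ.+-inverseʳ (x 0))))
  0<N′ : 0ℤ ℤ.< N′
  0<N′ = /1-cancel-< (subst (0ℚ <_) dm≡N′ (*-pos 0<d 0<m))
  N′<M : N′ ℤ.< + M
  N′<M = /1-cancel-< (subst₂ _<_ dm≡N′ (*-identityˡ m) (*-monoˡ-<-pos m {{positive 0<m}} d<1))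
  descend : ∀ K → K ≡ N′ → ⊥
  descend (+ k) eq = no-rational-limit fuel k
    (ℕ.s≤s⁻¹ (ℕₚ.<-≤-trans (ℤₚ.drop‿+<+ (subst (ℤ._< + M) (sym eq) N′<M)) M≤)) (x ∘ suc) (x⁺ ∘ suc) (+ M)
    sk≡M (subst (0ℤ ℤ.<_) (sym eq) 0<N′) lim′
    where
    sk≡M : s * (+ k / 1) ≡ + M / 1
    sk≡M = trans (cong (λ K → s * (K / 1)) eq) (trans (cong (s *_) (sym dm≡N′)) (trans (sym (*-assoc s d m))
      (trans (cong (_* m) (trans (*-comm s d) ds≡1)) (*-identityˡ m))))
  descend ℤ.-[1+ k ] eq = negative (sym eq) 0<N′
    where
    negative : ∀ {K k} → K ≡ ℤ.-[1+ k ] → ¬ (0ℤ ℤ.< K)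
    negative refl ()

irrational : ∀ x → Irrational (value x)
irrational x r = no-rational-limit (↧ₙ r) (↧ₙ r) ℕₚ.≤-refl (quotient x) (quotient-positive x) (↥ r)
  (*-denominator r) (ℤ.+<+ (s≤s z≤n))

-- The ray

ʳ++-digits : ∀ v {m} → Digits v → Digits m → Digits (v List.ʳ++ m)
ʳ++-digits []      _            m⁺ = m⁺
ʳ++-digits (d ∷ v) (d⁺ ∷ v⁺) m⁺ = ʳ++-digits v v⁺ (d⁺ ∷ m⁺)

block-digits : ∀ {r ε} (B : Block r ε) → Digits (block-word B)
block-digits B = ʳ++-digits v (accepts⇒digits after-4 v-accept)
  (ℕₚ.≤-trans (s≤s z≤n) 4≤a ∷ ℕₚ.≤-trans (s≤s z≤n) 4≤b ∷ accepts⇒digits after-4 w-accept)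
  where open Block B

0<1/suc : ∀ k → 0ℚ < 1/suc k
0<1/suc k = /-mono-< (+ 0) 0 (+ 1) k (ℤ.+<+ (s≤s z≤n))

quarter : ℚ → ℚ
quarter ε = ½ * (½ * ε)

0<quarter : ∀ {ε} → 0ℚ < ε → 0ℚ < quarter ε
0<quarter 0<ε = 0<½ε (0<½ε 0<ε)

four-quarters : ∀ x ε → x + quarter ε + quarter ε + (quarter ε + quarter ε) ≡ x + ε
four-quarters x ε = solve 2 (λ x ε → let η = con ½ :* (con ½ :* ε) in x :+ η :+ η :+ (η :+ η) := x :+ ε) refl x ε
  where open +-*-Solver

∣-∣<⇒<+ : ∀ {x y r} → ∣ x - y ∣ < r → x < y + r
∣-∣<⇒<+ {x} {y} {r} h = subst (_< y + r) (y+[x-y]≡x x y) (+-monoʳ-< y (≤-<-trans (p≤∣p∣ (x - y)) h))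

module _ (z : ℝ) (z≥ : fromℚ threshold Defs.≤ z) where

  private
    -- The hypothesis is only a negation, so single approximations of z may lie below the threshold
    -- and are raised to it. The limit is unaffected by `threshold≤`.
    r : ℕ → ℚ
    r k = seq z k ⊔ threshold

    blocks : ∀ k → Block (r k) (1/suc k)
    blocks k = block (r k) (1/suc k) (p≤q⊔p (seq z k) threshold) (0<1/suc k)

    words : ℕ → List ℕ
    words k = block-word (blocks k)

    words⁺ : ∀ k → Digits (words k)
    words⁺ k = block-digits (blocks k)

  open Concatenation words words⁺

  -- Were a late term below the threshold by more than ε, the Cauchy property would keep all later
  -- terms below it by ε/2, against `z≥`. Order on ℚ is decidable, so refuting this suffices.
  threshold≤ : ∀ ε → 0ℚ < ε → ∃ λ N → ∀ n → N ℕ.≤ n → threshold ≤ seq z n + ε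
  threshold≤ ε 0<ε =
    let N , h = cauchy z (½ * ε) (0<½ε 0<ε) in N , λ n N≤n → ≮⇒≥ λ z+ε< →
      z≥ (½ * ε , 0<½ε 0<ε , N , λ m N≤m → <-trans
        (subst (seq z m + ½ * ε <_) (halves (seq z n) ε)
          (+-monoˡ-< (½ * ε) (∣-∣<⇒<+ {seq z m} {seq z n} (h m n N≤m N≤n))))
        z+ε<)
    where
    halves : ∀ x ε → x + ½ * ε + ½ * ε ≡ x + ε
    halves = solve 2 (λ x ε → x :+ con ½ :* ε :+ con ½ :* ε := x :+ ε) refl
      where open +-*-Solver

  record Stable (ε : ℚ) (K : ℕ) : Set where
    field
      seq-close : ∀ {i j} → K ℕ.≤ i → K ℕ.≤ j → seq z i < seq z j + ε
      r≤        : ∀ {k} → K ℕ.≤ k → r k ≤ seq z k + ε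
      1/suc≤    : ∀ {k} → K ℕ.≤ k → 1/suc k ≤ ε

  stable : ∀ {ε} → 0ℚ < ε → ∃ (Stable ε)
  stable {ε} 0<ε =
    let N₁ , h₁ = cauchy z ε 0<ε
        N₂ , h₂ = threshold≤ ε 0<ε
        N₃ , h₃ = archimedean ε 0<ε
        N₁₂≤ : ∀ {k} → N₁ ℕ.⊔ N₂ ℕ.⊔ N₃ ℕ.≤ k → N₁ ℕ.⊔ N₂ ℕ.≤ k
        N₁₂≤ = ℕₚ.m⊔n≤o⇒m≤o (N₁ ℕ.⊔ N₂) N₃
    in N₁ ℕ.⊔ N₂ ℕ.⊔ N₃ , record
      { seq-close = λ {i} {j} i≥ j≥ → ∣-∣<⇒<+ {seq z i} {seq z j}
          (h₁ i j (ℕₚ.m⊔n≤o⇒m≤o N₁ N₂ (N₁₂≤ i≥)) (ℕₚ.m⊔n≤o⇒m≤o N₁ N₂ (N₁₂≤ j≥)))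
      ; r≤     = λ {k} k≥ → ⊔-lub (≤+nonNeg {seq z k} {ε} (<⇒≤ 0<ε)) (h₂ k (ℕₚ.m⊔n≤o⇒n≤o N₁ N₂ (N₁₂≤ k≥)))
      ; 1/suc≤ = λ {k} k≥ → ≤-trans (1/suc-antimono (ℕₚ.m⊔n≤o⇒n≤o (N₁ ℕ.⊔ N₂) N₃ k≥)) (<⇒≤ h₃)
      }

  product : ℕ → ℝ
  product n = fromℚ (reversed cf n) Defs.* value (tailFrom (suc n) cf)

  cut-bound : ∀ n → SideCut (r (stage (config n)) + 1/suc (stage (config n)))
    (backward (config n)) (forward (config n))
  cut-bound = config-cut {λ k → SideCut (r k + 1/suc k)} λ k →
    block-cuts (p≤q⊔p (seq z k) threshold) (<⇒≤ (0<1/suc k)) (blocks k)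

  product-below : ∀ ε → 0ℚ < ε → ∃ λ N → ∀ n → N ℕ.≤ n → product n Defs.< z Defs.+ fromℚ ε
  product-below ε 0<ε = bound (stable (0<quarter 0<ε))
    where
    η = quarter ε
    bound : ∃ (Stable η) → ∃ λ N → ∀ n → N ℕ.≤ n → product n Defs.< z Defs.+ fromℚ ε
    bound (K , S) = suc (proj₁ (stage-unbounded K)) , at
      where
      open Stable S
      at : ∀ n → suc (proj₁ (stage-unbounded K)) ℕ.≤ n → product n Defs.< z Defs.+ fromℚ ε
      -- The four quarters pay for raising `seq z k` to the threshold, the error of the block, the
      -- variation of `seq z`, and the margin of strict inequality.
      at (suc n) (s≤s N≤n) = η , 0<quarter 0<ε , K ℕ.⊔ suc (length (forward (config n))) , λ j j≥ →
        let k = stage (config n)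
            k≥ = proj₂ (stage-unbounded K) n N≤n
            σ , 1≤σ , rest = product-X n
            τ , 1≤τ , eq = rest j (ℕₚ.m⊔n≤o⇒n≤o K (suc (length (forward (config n)))) j≥)
            u≤ : seq (product (suc n)) j ≤ r k + 1/suc k
            u≤ = subst (_≤ r k + 1/suc k) (sym eq) (cut-bound n 1≤σ 1≤τ)
            open ≤-Reasoning
        in begin-strict
          seq (product (suc n)) j + η     ≤⟨ +-monoˡ-≤ η u≤ ⟩
          r k + 1/suc k + η               ≤⟨ +-monoˡ-≤ η (+-mono-≤ (r≤ k≥) (1/suc≤ k≥)) ⟩
          seq z k + η + η + η             ≡⟨ +-assoc (seq z k + η) η η ⟩
          seq z k + η + (η + η)           <⟨ +-monoˡ-< (η + η) (+-monoˡ-< η (seq-close k≥ (ℕₚ.m⊔n≤o⇒m≤o K _ j≥))) ⟩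
          seq z j + η + η + (η + η)       ≡⟨ four-quarters (seq z j) ε ⟩
          seq z j + ε                     ∎

  product-above : ∀ ε → 0ℚ < ε → ∀ M → ∃ λ n → M ℕ.≤ n × z Defs.< product n Defs.+ fromℚ ε
  product-above ε 0<ε M = bound (stable (0<quarter 0<ε))
    where
    η = quarter ε
    bound : ∃ (Stable η) → ∃ λ n → M ℕ.≤ n × z Defs.< product n Defs.+ fromℚ ε
    bound (K , S) = at (centres (K ℕ.⊔ M) {Block.a B ∷ Block.v B} {Block.b B ∷ Block.w B} refl)
      where
      open Stable S
      k = K ℕ.⊔ M
      B = blocks k
      open Block B
      at : (∃ λ n → k ℕ.≤ n × config n ≡ ⟨ k , closed (a ∷ v) , b ∷ w ⟩) →
        ∃ λ n → M ℕ.≤ n × z Defs.< product n Defs.+ fromℚ ε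
      at (n , k≤n , eq) = suc n , ℕₚ.m≤n⇒m≤1+n (ℕₚ.≤-trans (ℕₚ.m≤n⊔m K M) k≤n) ,
        η + η , +-mono-< (0<quarter 0<ε) (0<quarter 0<ε) , K ℕ.⊔ suc (length (forward (config n))) , λ j j≥ →
        let σ , 1≤σ , rest = product-X n
            τ , 1≤τ , eq′ = rest j (ℕₚ.m⊔n≤o⇒n≤o K (suc (length (forward (config n)))) j≥)
            k≥ = ℕₚ.m≤m⊔n K M
            u = seq (product (suc n)) j
            ≤u : r k ≤ u + 1/suc k
            ≤u = subst (λ y → r k ≤ y + 1/suc k)
              (sym (trans eq′ (trans (cong (λ c → X (backward c) σ * X (closed (forward c)) τ) eq)
                (cong₂ _*_ (X-++ (a ∷ v) (2 ∷ []) σ) (X-++ (b ∷ w) (2 ∷ []) τ)))))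
              (≤product (1≤X {2 ∷ []} (s≤s z≤n ∷ []) 1≤σ) (1≤X {2 ∷ []} (s≤s z≤n ∷ []) 1≤τ))
            open ≤-Reasoning
        in begin-strict
          seq z j + (η + η)               <⟨ +-monoˡ-< (η + η) (seq-close (ℕₚ.m⊔n≤o⇒m≤o K _ j≥) k≥) ⟩
          seq z k + η + (η + η)           ≤⟨ +-monoˡ-≤ (η + η) (+-monoˡ-≤ η (≤-trans (p≤p⊔q (seq z k) threshold) ≤u)) ⟩
          u + 1/suc k + η + (η + η)       ≤⟨ +-monoˡ-≤ (η + η) (+-monoˡ-≤ η (+-monoʳ-≤ u (1/suc≤ k≥))) ⟩
          u + η + η + (η + η)             ≡⟨ four-quarters u ε ⟩
          u + ε                           ∎

  ≥threshold⇒Ω̄ : Ω̄ z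
  ≥threshold⇒Ω̄ = value cf , irrational cf , cf ,
    (λ ε 0<ε → 0 , λ n _ → subst (_< ε) (sym (cong ∣_∣ (+-inverseʳ (convergent sequence n)))) 0<ε) ,
    product-below , product-above

-- Comparison of the threshold with the stated constant

√-seq-lower : ∀ m c n → c ℕ.* c ℕ.≤ m → ⌜ c ⌝ ≤ √-seq m n
√-seq-lower m c n c²≤m = /-mono-≤ (+ c) 0 (+ s) n
  (subst₂ ℤ._≤_ (ℤₚ.pos-* c (suc n)) (sym (ℤₚ.*-identityʳ (+ s))) (ℤ.+≤+ cN≤s))
  where
  s N : ℕ
  s = isqrt (m ℕ.* (suc n ℕ.* suc n))
  N = suc n
  cN≤s : c ℕ.* N ℕ.≤ s
  cN≤s = ℕₚ.≮⇒≥ λ s<cN → ℕₚ.<⇒≱ (isqrt-upper (m ℕ.* (N ℕ.* N))) (begin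
    suc s ℕ.* suc s          ≤⟨ ℕₚ.*-mono-≤ s<cN s<cN ⟩
    c ℕ.* N ℕ.* (c ℕ.* N)    ≡⟨ ℕ-solve 2 (λ c N → c ⊛ N ⊛ (c ⊛ N) ⊜ c ⊛ c ⊛ (N ⊛ N)) refl c N ⟩
    c ℕ.* c ℕ.* (N ℕ.* N)    ≤⟨ ℕₚ.*-monoˡ-≤ (N ℕ.* N) c²≤m ⟩
    m ℕ.* (N ℕ.* N)          ∎)
    where
    open ℕₚ.≤-Reasoning
    open ℕ-Solver.+-*-Solver renaming (solve to ℕ-solve; _:*_ to infixl 7 _⊛_; _:=_ to _⊜_)

-- Stated for a variable m so that isqrt does not unfold on multiples of 26565.
bound-≤ : ∀ m → 162 ℕ.* 162 ℕ.≤ m → ∀ n →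
  threshold ≤ seq ((fromℚ (+ 19425 / 1) Defs.+ fromℚ (+ 111 / 1) Defs.* √ m) Defs.* fromℚ (+ 1 / 2030)) n
bound-≤ m h n = ≤-trans
  (from-yes (threshold ≤? (+ 19425 / 1 + + 111 / 1 * ⌜ 162 ⌝) * (+ 1 / 2030)))
  (*-monoʳ (+ 1 / 2030) (from-yes (0ℚ ≤? + 1 / 2030))
    (+-monoʳ-≤ (+ 19425 / 1) (*-monoˡ (+ 111 / 1) (from-yes (0ℚ ≤? + 111 / 1)) (√-seq-lower m 162 n h))))

bound-from-above : ∀ m → 162 ℕ.* 162 ℕ.≤ m →
  μ ≤ᵘ (fromℚ (+ 19425 / 1) Defs.+ fromℚ (+ 111 / 1) Defs.* √ m) Defs.* fromℚ (+ 1 / 2030)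
bound-from-above m h r (ε , 0<ε , N , bound<r) =
  fromℚ threshold , (λ {z} → ≥threshold⇒Ω̄ z) , ε , 0<ε , N , λ n N≤n →
    ≤-<-trans (+-monoˡ-≤ ε (bound-≤ m h n)) (bound<r n N≤n)

theorem1p3 : μ ≤ᵘ (fromℚ (+ 19425 / 1) Defs.+ fromℚ (+ 111 / 1) Defs.* √ 26565) Defs.* fromℚ (+ 1 / 2030)
-- 162 is the integer part of √26565, and (19425 + 111 · 162)/2030 ≈ 18.427 already exceeds 92/5.
theorem1p3 = bound-from-above 26565 (from-yes (162 ℕ.* 162 ℕₚ.≤? 26565))
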